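{- Let $n$ be an odd positive integer and let $k$ be a positive integer such that $k$ divides $n2^{n-1}$ and $k \leq n$. Then the $n$-dimensional hypercube $Q_n$ can be decomposed into paths of length $k$.
   Context: The $n$-dimensional hypercube $Q_n$ is the graph with vertex set $\{0,1\}^n$ in which two vertices $x,y$ are adjacent iff $\|x-y\|_1 = 1$. A path of length $k$ is a sequence of distinct vertices $x_1,\dots,x_{k+1}$ with $x_i x_{i+1}$ an edge for all $1\le i\le k$. A decomposition of a graph into paths of length $k$ is a collection of paths of length $k$ in the graph whose edge sets partition the edge set of the graph (every edge lies in exactly one of the paths). -}

module Defs where

open import Data.Nat using (ℕ; zero; suc; _+_; _*_; _∸_; _^_; _≤_)
open import Data.Bool using (Bool; true; false)
open import Data.Fin using (Fin; inject₁) renaming (suc to fsuc)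
open import Data.Vec using (Vec; lookup)
open import Data.Product using (Σ; _×_; _,_; ∃)
open import Data.Sum using (_⊎_)
open import Relation.Binary.PropositionalEquality using (_≡_; _≢_)
open import Function.Definitions using (Injective)

Vertex : ℕ → Set
Vertex n = Vec Bool n

Adjacent : {n : ℕ} → Vertex n → Vertex n → Set
Adjacent {n} x y =
  Σ (Fin n) λ i → (lookup x i ≢ lookup y i) ×
    ((j : Fin n) → j ≢ i → lookup x j ≡ lookup y j)

record Path (n k : ℕ) : Set where
  field
    vert     : Fin (suc k) → Vertex n
    distinct : Injective _≡_ _≡_ vert
    steps    : (i : Fin k) → Adjacent (vert (inject₁ i)) (vert (fsuc i))
open Path public

StepIs : {n k : ℕ} → Path n k → Fin k → Vertex n → Vertex n → Set
StepIs p i x y =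
  (vert p (inject₁ i) ≡ x × vert p (fsuc i) ≡ y) ⊎
  (vert p (inject₁ i) ≡ y × vert p (fsuc i) ≡ x)

-- A decomposition of Q_n into paths of length k: a finite family of paths
-- whose edge sets partition E(Q_n): every edge {x,y} of Q_n occurs as a step
-- of exactly one path, at exactly one position.  (Edges of the paths are
-- automatically edges of Q_n, since path steps are adjacencies.)
PathDecomposition : ℕ → ℕ → Set
PathDecomposition n k =
  Σ ℕ λ m → Σ (Fin m → Path n k) λ P →
    (x y : Vertex n) → Adjacent x y →
      Σ (Fin m × Fin k) λ { (j , i) →
        StepIs (P j) i x y ×
        ((j′ : Fin m) (i′ : Fin k) → StepIs (P j′) i′ x y → (j′ ≡ j) × (i′ ≡ i)) }

{-# OPTIONS --safe #-}
module Submission where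

open import Defs
open import Data.Nat using (ℕ; suc; _+_; _*_; _∸_; _^_; _≤_; _<_)
open import Relation.Binary.PropositionalEquality using (_≡_)
open import Data.Product using (∃)
open import Data.Nat.Divisibility using (_∣_)

open import Data.Nat using (zero; z≤n; s≤s; z<s; s≤s⁻¹)
open import Data.Nat.Properties hiding (suc-injective)
open import Data.Bool using (Bool; true; false; not; _xor_; if_then_else_)
open import Data.Bool.Properties using (not-involutive; ¬-not; not-¬; not-distribˡ-xor; not-distribʳ-xor)
open import Data.Empty using (⊥; ⊥-elim)
open import Data.Unit using (⊤; tt)
open import Data.Fin using (Fin; zero; suc; toℕ; fromℕ<; inject₁; combine; remQuot; _↑ˡ_; _↑ʳ_; splitAt)
open import Data.Fin.Properties using
  (toℕ-injective; toℕ<n; toℕ-fromℕ<; toℕ-inject₁; toℕ-combine; remQuot-combine; combine-remQuot;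
   join-splitAt; suc-injective)
open import Data.Product using (Σ; _×_; _,_; proj₁; proj₂; uncurry)
open import Data.Sum using (_⊎_; inj₁; inj₂; [_,_])
open import Data.Vec using (Vec; []; _∷_; lookup; map; _++_; concat; replicate; tabulate; take; drop; head; tail)
open import Data.Vec.Properties using
  (lookup-map; lookup-++ˡ; lookup-++ʳ; lookup-concat; lookup-replicate; lookup∘tabulate; map-∘; map-id; ++-injective; take++drop≡id)
open import Axiom.UniquenessOfIdentityProofs.WithK using (uip)
open import Data.Nat.Coprimality using (Coprime; coprime-divisor)
open import Data.Nat.Divisibility using (divides; ∣-trans; ∣⇒≤; ∣m+n∣m⇒∣n; ∣m⇒∣m*n; 0∣⇒≡0)
open import Data.Nat.Solver using (module +-*-Solver)
open +-*-Solver using (solve; _:=_; _:+_; _:*_; con)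
open import Function using (_∘_; id)
open import Relation.Nullary using (¬_; yes; no; contradiction)
open import Relation.Binary.PropositionalEquality using (_≢_; refl; sym; trans; cong; cong₂; subst; module ≡-Reasoning)

-- Write n = (2c + 1) d and k = 2ˢ d with d = 2h + 1 odd; longer paths can be cut, so let s be maximal with
-- 2ˢ ≤ 2c + 1.  Orienting Q₂ as a 4-cycle turns Q_{n-1} into a union of permutations of the vertices, and other
-- such unions arise by exchanging two permutations on the vertices of one parity.  In a product of two orientations
-- an exchange between the factors doubles cycle lengths, so that Q_{2c} becomes a union of 2c + 1 - 2ˢ "live"
-- permutations with all cycle lengths divisible by 2ˢ⁺¹ and l = 2ˢ - 1 - c "dead" ones, which applied in succession
-- to any vertex trace a path.
-- Put d copies of this and h further 4-cycles on the half x₀ = 0 of Q_n, and only 4-cycles on the half x₀ = 1.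
-- From every vertex of the first half apply all dead permutations, cross to the other half and apply all its
-- permutations: a path of length (dl + h) + 1 + (dc + h) = k.  The live permutations of the d copies, applied
-- cyclically in 2ˢ rounds of d, give paths of length k covering the remaining edges.

private variable
  A B I J K X Y : Set
  a b k m n : ℕ

-- Finite enumerations

-- Kept as a vector with an inverse because the order matters: read as a word, the list of labels is
-- itself the walk to follow, and `pos` tells where a label is used.
record Enum (A : Set) (n : ℕ) : Set where
  field
    word     : Vec A n
    pos      : A → Fin n
    word-pos : ∀ a → lookup word (pos a) ≡ a
    pos-word : ∀ t → pos (lookup word t) ≡ t
open Enum

enum-⊥ : Enum ⊥ 0
enum-⊥ = record { word = [] ; pos = λ () ; word-pos = λ () ; pos-word = λ () }

enum-⊤ : Enum ⊤ 1
enum-⊤ = record { word = tt ∷ [] ; pos = λ _ → zero ; word-pos = λ _ → refl ; pos-word = λ { zero → refl } }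

enum-Bool : Enum Bool 2
enum-Bool = record
  { word = false ∷ true ∷ [] ; pos = λ { false → zero ; true → suc zero }
  ; word-pos = λ { false → refl ; true → refl } ; pos-word = λ { zero → refl ; (suc zero) → refl } }

enum-⊎ : Enum A m → Enum B n → Enum (A ⊎ B) (m + n)
enum-⊎ {A} {m} {B} {n} e f = record
  { word = map inj₁ (word e) ++ map inj₂ (word f) ; pos = p ; word-pos = wp ; pos-word = pw }
  where
  p : A ⊎ B → Fin (m + n)
  p = [ (λ x → pos e x ↑ˡ n) , (λ y → m ↑ʳ pos f y) ]
  w : Vec (A ⊎ B) (m + n)
  w = map inj₁ (word e) ++ map inj₂ (word f)
  wˡ : ∀ t → lookup w (t ↑ˡ n) ≡ inj₁ (lookup (word e) t)
  wˡ t = trans (lookup-++ˡ (map inj₁ (word e)) _ t) (lookup-map t inj₁ (word e))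
  wʳ : ∀ t → lookup w (m ↑ʳ t) ≡ inj₂ (lookup (word f) t)
  wʳ t = trans (lookup-++ʳ (map inj₁ (word e)) _ t) (lookup-map t inj₂ (word f))
  wp : ∀ x → lookup w (p x) ≡ x
  wp (inj₁ x) = trans (wˡ _) (cong inj₁ (word-pos e x))
  wp (inj₂ y) = trans (wʳ _) (cong inj₂ (word-pos f y))
  pw : ∀ t → p (lookup w t) ≡ t
  pw t with splitAt m t | join-splitAt m n t
  ... | inj₁ i | refl = trans (cong p (wˡ i)) (cong (_↑ˡ n) (pos-word e i))
  ... | inj₂ j | refl = trans (cong p (wʳ j)) (cong (m ↑ʳ_) (pos-word f j))

enum-map : (f : A → B) (g : B → A) → (∀ y → f (g y) ≡ y) → (∀ x → g (f x) ≡ x) → Enum A n → Enum B n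
enum-map f g fg gf e = record
  { word = map f (word e) ; pos = pos e ∘ g
  ; word-pos = λ y → trans (lookup-map _ f (word e)) (trans (cong f (word-pos e (g y))) (fg y))
  ; pos-word = λ t → trans (cong (pos e ∘ g) (lookup-map t f (word e)))
                       (trans (cong (pos e) (gf _)) (pos-word e t)) }

enum-Fin : ∀ n → Enum (Fin n) n
enum-Fin n = record { word = tabulate id ; pos = id ; word-pos = lookup∘tabulate id ; pos-word = lookup∘tabulate id }

enum-× : Enum A m → Enum B n → Enum (A × B) (m * n)
enum-× {m = m} {n = n} e f = enum-map
  (λ t → let (i , j) = remQuot {m} n t in lookup (word e) i , lookup (word f) j)
  (λ (x , y) → combine (pos e x) (pos f y))
  (λ (x , y) → trans (cong (λ (i , j) → lookup (word e) i , lookup (word f) j) (remQuot-combine (pos e x) (pos f y)))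
                     (cong₂ _,_ (word-pos e x) (word-pos f y)))
  (λ t → trans (cong₂ combine (pos-word e _) (pos-word f _)) (combine-remQuot {m} n t))
  (enum-Fin (m * n))

enum-Vertex : ∀ n → Enum (Vertex n) (2 ^ n)
enum-Vertex zero = enum-map (λ _ → []) (λ _ → tt) (λ { [] → refl }) (λ _ → refl) enum-⊤
enum-Vertex (suc n) = enum-map (λ (b , v) → b ∷ v) (λ { (b ∷ v) → b , v }) (λ { (b ∷ v) → refl }) (λ _ → refl)
  (enum-× enum-Bool (enum-Vertex n))

enum-≡true : ∀ b → Σ ℕ (Enum (b ≡ true))
enum-≡true false = 0 , record { word = [] ; pos = λ () ; word-pos = λ () ; pos-word = λ () }
enum-≡true true = 1 , record { word = refl ∷ [] ; pos = λ _ → zero ; word-pos = λ { refl → refl } ; pos-word = λ { zero → refl } }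

enum-filterFin : ∀ n (p : Fin n → Bool) → Σ ℕ (Enum (Σ (Fin n) λ t → p t ≡ true))
enum-filterFin zero p = 0 , record { word = [] ; pos = λ { (() , _) } ; word-pos = λ { (() , _) } ; pos-word = λ () }
enum-filterFin (suc n) p with enum-≡true (p zero) | enum-filterFin n (p ∘ suc)
... | m , e | m′ , e′ = m + m′ , enum-map
  [ (λ q → zero , q) , (λ (t , q) → suc t , q) ]
  (λ { (zero , q) → inj₁ q ; (suc t , q) → inj₂ (t , q) })
  (λ { (zero , q) → refl ; (suc t , q) → refl })
  (λ { (inj₁ q) → refl ; (inj₂ y) → refl })
  (enum-⊎ e e′)

enum-filter : Enum A n → (p : A → Bool) → Σ ℕ (Enum (Σ A λ x → p x ≡ true))
enum-filter {A} {n} e p with enum-filterFin n (p ∘ lookup (word e))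
... | m , f = m , enum-map
  (λ (t , q) → lookup (word e) t , q)
  (λ (x , q) → pos e x , trans (cong p (word-pos e x)) q)
  (λ (x , q) → Σ-≡ p (word-pos e x)) (λ (t , q) → Σ-≡ _ (pos-word e t)) f
  where
  Σ-≡ : (p : X → Bool) {x y : X} {q : p x ≡ true} {r : p y ≡ true} → x ≡ y →
    _≡_ {A = Σ X λ x → p x ≡ true} (x , q) (y , r)
  Σ-≡ p refl = cong (_ ,_) (uip _ _)

-- Walks: a letter i moves a vertex by nxt i, and prv i undoes the move.

module _ (nxt : I → X → X) where

  at : X → Vec I k → Fin (suc k) → X
  at x w zero = x
  at x (i ∷ w) (suc t) = at (nxt i x) w t

  Visits : X → Vec I k → X → Set
  Visits x [] v = x ≡ v
  Visits x (i ∷ w) v = x ≡ v ⊎ Visits (nxt i x) w v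

  Simple : X → Vec I k → Set
  Simple x [] = ⊤
  Simple x (i ∷ w) = ¬ Visits (nxt i x) w x × Simple (nxt i x) w

  visits-start : ∀ {x} (w : Vec I k) → Visits x w x
  visits-start [] = refl
  visits-start (i ∷ w) = inj₁ refl

  visits-at : ∀ x (w : Vec I k) t → Visits x w (at x w t)
  visits-at x [] zero = refl
  visits-at x (i ∷ w) zero = inj₁ refl
  visits-at x (i ∷ w) (suc t) = inj₂ (visits-at (nxt i x) w t)

  at-injective : ∀ x (w : Vec I k) → Simple x w → ∀ {s t} → at x w s ≡ at x w t → s ≡ t
  at-injective x w _ {zero} {zero} _ = refl
  at-injective x (i ∷ w) (¬v , _) {zero} {suc t} eq = ⊥-elim (¬v (subst (Visits _ w) (sym eq) (visits-at _ w t)))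
  at-injective x (i ∷ w) (¬v , _) {suc s} {zero} eq = ⊥-elim (¬v (subst (Visits _ w) eq (visits-at _ w s)))
  at-injective x (i ∷ w) (_ , σ) {suc s} {suc t} eq = cong suc (at-injective _ w σ eq)

  at-suc : ∀ x (w : Vec I k) t → at x w (suc t) ≡ nxt (lookup w t) (at x w (inject₁ t))
  at-suc x (i ∷ w) zero = refl
  at-suc x (i ∷ w) (suc t) = at-suc (nxt i x) w t

module _ (prv : I → X → X) where

  rewind : Vec I k → X → X
  rewind [] x = x
  rewind (i ∷ w) x = prv i (rewind w x)

  -- The start of the walk along `w` that stands at `x` just before letter `t`. By `at-back` and
  -- `back-at`, when the letters act as permutations each `x` stands at place `t` of exactly one
  -- walk.
  back : Vec I k → Fin k → X → X
  back (i ∷ w) zero x = x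
  back (i ∷ w) (suc t) x = prv i (back w t x)

  rewind^ : ℕ → Vec I k → X → X
  rewind^ zero w x = x
  rewind^ (suc q) w x = rewind w (rewind^ q w x)

  back-++ : ∀ (v : Vec I m) (w : Vec I n) t x → back (v ++ w) (m ↑ʳ t) x ≡ rewind v (back w t x)
  back-++ [] w t x = refl
  back-++ (i ∷ v) w t x = cong (prv i) (back-++ v w t x)

  back-++ˡ : ∀ (v : Vec I m) (w : Vec I n) t x → back (v ++ w) (t ↑ˡ n) x ≡ back v t x
  back-++ˡ (i ∷ v) w zero x = refl
  back-++ˡ (i ∷ v) w (suc t) x = cong (prv i) (back-++ˡ v w t x)

  -- A place in repeated rounds splits into `q` full rounds and a place `t` in the next one; the
  -- unfinished round is undone first.
  back-concat : ∀ N (w : Vec I k) (q : Fin N) t x →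
    back (concat (replicate N w)) (combine q t) x ≡ rewind^ (toℕ q) w (back w t x)
  back-concat (suc N) w zero t x = back-++ˡ w _ t x
  back-concat (suc N) w (suc q) t x =
    trans (back-++ w _ (combine q t) x) (cong (rewind w) (back-concat N w q t x))

module _ (nxt prv : I → X → X) where

  at-back : (∀ i x → nxt i (prv i x) ≡ x) → ∀ (w : Vec I k) t x → at nxt (back prv w t x) w (inject₁ t) ≡ x
  at-back np (i ∷ w) zero x = refl
  at-back np (i ∷ w) (suc t) x rewrite np i (back prv w t x) = at-back np w t x

  back-at : (∀ i x → prv i (nxt i x) ≡ x) → ∀ (w : Vec I k) t x → back prv w t (at nxt x w (inject₁ t)) ≡ x
  back-at pn (i ∷ w) zero x = refl
  back-at pn (i ∷ w) (suc t) x = trans (cong (prv i) (back-at pn w t (nxt i x))) (pn i x)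

-- A walk in a product each of whose steps moves one coordinate, together with its two projections.

data Shuffle (nxt : K → X × Y → X × Y) (nxtˡ : I → X → X) (nxtʳ : J → Y → Y) :
  X → Y → Vec K m → Vec I a → Vec J b → Set where
  nil   : ∀ {x y} → Shuffle nxt nxtˡ nxtʳ x y [] [] []
  left  : ∀ {x y k i} {w : Vec K m} {u : Vec I a} {v : Vec J b} → nxt k (x , y) ≡ (nxtˡ i x , y) →
    Shuffle nxt nxtˡ nxtʳ (nxtˡ i x) y w u v → Shuffle nxt nxtˡ nxtʳ x y (k ∷ w) (i ∷ u) v
  right : ∀ {x y k j} {w : Vec K m} {u : Vec I a} {v : Vec J b} → nxt k (x , y) ≡ (x , nxtʳ j y) →
    Shuffle nxt nxtˡ nxtʳ x (nxtʳ j y) w u v → Shuffle nxt nxtˡ nxtʳ x y (k ∷ w) u (j ∷ v)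

module _ {nxt : K → X × Y → X × Y} {nxtˡ : I → X → X} {nxtʳ : J → Y → Y} where

  shuffle-visits : ∀ {x y} {w : Vec K m} {u : Vec I a} {v : Vec J b} → Shuffle nxt nxtˡ nxtʳ x y w u v →
    ∀ {x′ y′} → Visits nxt (x , y) w (x′ , y′) → Visits nxtˡ x u x′ × Visits nxtʳ y v y′
  shuffle-visits nil refl = refl , refl
  shuffle-visits (left {v = v} _ s) (inj₁ refl) = inj₁ refl , visits-start nxtʳ v
  shuffle-visits (left eq s) (inj₂ vis) rewrite eq with shuffle-visits s vis
  ... | p , q = inj₂ p , q
  shuffle-visits (right {u = u} _ s) (inj₁ refl) = visits-start nxtˡ u , inj₁ refl
  shuffle-visits (right eq s) (inj₂ vis) rewrite eq with shuffle-visits s vis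
  ... | p , q = p , inj₂ q

  -- The coordinate moved by the first step never regains its initial value in its own projection,
  -- so the pair cannot return either. Products of plain orientations, systems and threads all rest
  -- on this.
  shuffle-simple : ∀ {x y} {w : Vec K m} {u : Vec I a} {v : Vec J b} → Shuffle nxt nxtˡ nxtʳ x y w u v →
    Simple nxtˡ x u → Simple nxtʳ y v → Simple nxt (x , y) w
  shuffle-simple nil _ _ = tt
  shuffle-simple (left eq s) (¬v , σ) τ rewrite eq =
    (λ vis → ¬v (proj₁ (shuffle-visits s vis))) , shuffle-simple s σ τ
  shuffle-simple (right eq s) σ (¬v , τ) rewrite eq =
    (λ vis → ¬v (proj₂ (shuffle-visits s vis))) , shuffle-simple s σ τ

  shuffle-right : (h : B → K) (g : B → J) → (∀ b x y → nxt (h b) (x , y) ≡ (x , nxtʳ (g b) y)) →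
    ∀ x y (v : Vec B n) → Shuffle nxt nxtˡ nxtʳ x y (map h v) [] (map g v)
  shuffle-right h g eq x y [] = nil
  shuffle-right h g eq x y (j ∷ v) = right (eq j x y) (shuffle-right h g eq x _ v)

  -- The renaming `h` lets one lemma serve both twisted orientations and regrouped labels.
  shuffle-⊎ : (h : A ⊎ B → K) (f : A → I) (g : B → J) →
    (∀ a x y → nxt (h (inj₁ a)) (x , y) ≡ (nxtˡ (f a) x , y)) →
    (∀ b x y → nxt (h (inj₂ b)) (x , y) ≡ (x , nxtʳ (g b) y)) →
    ∀ x y (u : Vec A m) (v : Vec B n) →
    Shuffle nxt nxtˡ nxtʳ x y (map h (map inj₁ u ++ map inj₂ v)) (map f u) (map g v)
  shuffle-⊎ h f g eqˡ eqʳ x y [] v rewrite sym (map-∘ h inj₂ v) = shuffle-right (h ∘ inj₂) g eqʳ x y v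
  shuffle-⊎ h f g eqˡ eqʳ x y (i ∷ u) v = left (eqˡ i x y) (shuffle-⊎ h f g eqˡ eqʳ _ y u v)

  shuffle-++ : ∀ {x y} {w : Vec K m} {u : Vec I a} {v : Vec J b} {w′ : Vec K n} {k} {u′ : Vec I k} {l} {v′ : Vec J l} →
    Shuffle nxt nxtˡ nxtʳ x y w u v → (∀ x y → Shuffle nxt nxtˡ nxtʳ x y w′ u′ v′) →
    Shuffle nxt nxtˡ nxtʳ x y (w ++ w′) (u ++ u′) (v ++ v′)
  shuffle-++ nil s′ = s′ _ _
  shuffle-++ (left eq s) s′ = left eq (shuffle-++ s s′)
  shuffle-++ (right eq s) s′ = right eq (shuffle-++ s s′)

  shuffle-concat : ∀ N {w : Vec K m} {u : Vec I a} {v : Vec J b} → (∀ x y → Shuffle nxt nxtˡ nxtʳ x y w u v) →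
    ∀ x y → Shuffle nxt nxtˡ nxtʳ x y (concat (replicate N w)) (concat (replicate N u)) (concat (replicate N v))
  shuffle-concat zero s x y = nil
  shuffle-concat (suc N) s x y = shuffle-++ (s x y) (shuffle-concat N s)

-- Adjacency in the hypercube, inductively

data Edge : Vertex n → Vertex n → Set where
  here  : ∀ {b b′} {v w : Vertex n} → b′ ≡ not b → v ≡ w → Edge (b ∷ v) (b′ ∷ w)
  there : ∀ {b b′} {v w : Vertex n} → b ≡ b′ → Edge v w → Edge (b ∷ v) (b′ ∷ w)

lookup-extensional : (v w : Vec A n) → (∀ i → lookup v i ≡ lookup w i) → v ≡ w
lookup-extensional [] [] _ = refl
lookup-extensional (x ∷ v) (y ∷ w) eq = cong₂ _∷_ (eq zero) (lookup-extensional v w (eq ∘ suc))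

adjacent⇒edge : (x y : Vertex n) → Adjacent x y → Edge x y
adjacent⇒edge (b ∷ v) (b′ ∷ w) (zero , ne , eq) =
  here (¬-not (ne ∘ sym)) (lookup-extensional v w (λ i → eq (suc i) λ ()))
adjacent⇒edge (b ∷ v) (b′ ∷ w) (suc i , ne , eq) =
  there (eq zero λ ()) (adjacent⇒edge v w (i , ne , λ j j≢i → eq (suc j) (j≢i ∘ suc-injective)))

edge⇒adjacent : {x y : Vertex n} → Edge x y → Adjacent x y
edge⇒adjacent (here refl refl) =
  zero , not-¬ refl , λ { zero j≢j → contradiction refl j≢j ; (suc j) _ → refl }
edge⇒adjacent (there refl e) with edge⇒adjacent e
... | i , ne , eq = suc i , ne , λ { zero _ → refl ; (suc j) j≢i → eq j (j≢i ∘ cong suc) }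

-- The single differing bit lies in one of the two blocks, so an edge of a product cube moves one
-- factor only.
edge-++ : (x x′ : Vertex m) {y y′ : Vertex n} → Edge (x ++ y) (x′ ++ y′) →
  (Edge x x′ × y ≡ y′) ⊎ (x ≡ x′ × Edge y y′)
edge-++ [] [] e = inj₂ (refl , e)
edge-++ (b ∷ x) (b′ ∷ x′) (here p q) with ++-injective x x′ q
... | q₁ , q₂ = inj₁ (here p q₁ , q₂)
edge-++ (b ∷ x) (b′ ∷ x′) (there p e) with edge-++ x x′ e
... | inj₁ (e′ , q) = inj₁ (there p e′ , q)
... | inj₂ (refl , e′) = inj₂ (cong (_∷ x) p , e′)

edge-++ˡ : {x x′ : Vertex m} {y : Vertex n} → Edge x x′ → Edge (x ++ y) (x′ ++ y)
edge-++ˡ (here p refl) = here p refl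
edge-++ˡ (there p e) = there p (edge-++ˡ e)

edge-++ʳ : (x : Vertex m) {y y′ : Vertex n} → Edge y y′ → Edge (x ++ y) (x ++ y′)
edge-++ʳ [] e = e
edge-++ʳ (b ∷ x) e = there refl (edge-++ʳ x e)

-- Orientations of a hypercube into permutations

-- Vertices form any type in bijection with bit vectors, so that products have pairs as vertices.
-- The field `flip` of an orientation makes `par` a proper 2-colouring.
record Cube : Set₁ where
  field
    V       : Set
    dim     : ℕ
    enc     : V → Vertex dim
    dec     : Vertex dim → V
    dec-enc : ∀ x → dec (enc x) ≡ x
    enc-dec : ∀ v → enc (dec v) ≡ v
    par     : V → Bool

  enc-injective : ∀ {x y} → enc x ≡ enc y → x ≡ y
  enc-injective {x} {y} eq = trans (sym (dec-enc x)) (trans (cong dec eq) (dec-enc y))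

-- Each edge is oriented as x → nxt i x for exactly one pair (x , i), and each nxt i is a permutation.
record Orientation (Q : Cube) (I : Set) : Set where
  open Cube Q
  field
    nxt prv : I → V → V
    prv-nxt : ∀ i x → prv i (nxt i x) ≡ x
    nxt-prv : ∀ i x → nxt i (prv i x) ≡ x
    edge    : ∀ i x → Edge (enc x) (enc (nxt i x))
    orient  : ∀ x y → Edge (enc x) (enc y) → Σ I λ i → nxt i x ≡ y ⊎ nxt i y ≡ x
    det     : ∀ {i j} x → nxt i x ≡ nxt j x → i ≡ j
    asym    : ∀ i j x → nxt i (nxt j x) ≢ x
    flip    : ∀ i x → par (nxt i x) ≡ not (par x)

  nxt-≢ : ∀ i x → nxt i x ≢ x
  nxt-≢ i x eq = not-¬ (cong par eq) (flip i x)

_×ᶜ_ : Cube → Cube → Cube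
Q ×ᶜ R = record
  { V = Q.V × R.V ; dim = Q.dim + R.dim
  ; enc = λ (x , y) → Q.enc x ++ R.enc y
  ; dec = λ v → Q.dec (take Q.dim v) , R.dec (drop Q.dim v)
  ; dec-enc = λ (x , y) → cong₂ _,_
      (trans (cong Q.dec (proj₁ (++-injective _ _ (take++drop≡id Q.dim (Q.enc x ++ R.enc y))))) (Q.dec-enc x))
      (trans (cong R.dec (proj₂ (++-injective _ _ (take++drop≡id Q.dim (Q.enc x ++ R.enc y))))) (R.dec-enc y))
  ; enc-dec = λ v → trans (cong₂ _++_ (Q.enc-dec _) (R.enc-dec _)) (take++drop≡id Q.dim v)
  ; par = λ (x , y) → Q.par x xor R.par y }
  where
  module Q = Cube Q
  module R = Cube R

_×ᵒ_ : ∀ {Q R} → Orientation Q I → Orientation R J → Orientation (Q ×ᶜ R) (I ⊎ J)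
_×ᵒ_ {I} {J} {Q} {R} O P = record
  { nxt = nxt′ ; prv = prv′
  ; prv-nxt = λ { (inj₁ i) (x , y) → cong (_, y) (O.prv-nxt i x) ; (inj₂ j) (x , y) → cong (x ,_) (P.prv-nxt j y) }
  ; nxt-prv = λ { (inj₁ i) (x , y) → cong (_, y) (O.nxt-prv i x) ; (inj₂ j) (x , y) → cong (x ,_) (P.nxt-prv j y) }
  ; edge = λ { (inj₁ i) (x , y) → edge-++ˡ (O.edge i x) ; (inj₂ j) (x , y) → edge-++ʳ (Q.enc x) (P.edge j y) }
  ; orient = orient′ ; det = det′ ; asym = asym′
  ; flip = λ { (inj₁ i) (x , y) → trans (cong (_xor R.par y) (O.flip i x)) (sym (not-distribˡ-xor (Q.par x) _))
             ; (inj₂ j) (x , y) → trans (cong (Q.par x xor_) (P.flip j y)) (sym (not-distribʳ-xor (Q.par x) _)) } }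
  where
  module Q = Cube Q
  module R = Cube R
  module O = Orientation O
  module P = Orientation P
  nxt′ prv′ : I ⊎ J → Q.V × R.V → Q.V × R.V
  nxt′ (inj₁ i) (x , y) = O.nxt i x , y
  nxt′ (inj₂ j) (x , y) = x , P.nxt j y
  prv′ (inj₁ i) (x , y) = O.prv i x , y
  prv′ (inj₂ j) (x , y) = x , P.prv j y
  orient′ : ∀ x y → Edge (Cube.enc (Q ×ᶜ R) x) (Cube.enc (Q ×ᶜ R) y) → Σ (I ⊎ J) λ i → nxt′ i x ≡ y ⊎ nxt′ i y ≡ x
  orient′ (x , y) (x′ , y′) e with edge-++ (Q.enc x) (Q.enc x′) e
  ... | inj₁ (e′ , eq) with R.enc-injective eq | O.orient x x′ e′
  ...   | refl | i , inj₁ p = inj₁ i , inj₁ (cong (_, y) p)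
  ...   | refl | i , inj₂ p = inj₁ i , inj₂ (cong (_, y) p)
  orient′ (x , y) (x′ , y′) e | inj₂ (eq , e′) with Q.enc-injective eq | P.orient y y′ e′
  ...   | refl | j , inj₁ p = inj₂ j , inj₁ (cong (x ,_) p)
  ...   | refl | j , inj₂ p = inj₂ j , inj₂ (cong (x ,_) p)
  det′ : ∀ {i j} x → nxt′ i x ≡ nxt′ j x → i ≡ j
  det′ {inj₁ i} {inj₁ j} (x , y) eq = cong inj₁ (O.det x (cong proj₁ eq))
  det′ {inj₂ i} {inj₂ j} (x , y) eq = cong inj₂ (P.det y (cong proj₂ eq))
  det′ {inj₁ i} {inj₂ j} (x , y) eq = ⊥-elim (O.nxt-≢ i x (cong proj₁ eq))
  det′ {inj₂ i} {inj₁ j} (x , y) eq = ⊥-elim (P.nxt-≢ i y (cong proj₂ eq))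
  asym′ : ∀ i j x → nxt′ i (nxt′ j x) ≢ x
  asym′ (inj₁ i) (inj₁ j) (x , y) eq = O.asym i j x (cong proj₁ eq)
  asym′ (inj₂ i) (inj₂ j) (x , y) eq = P.asym i j y (cong proj₂ eq)
  asym′ (inj₁ i) (inj₂ j) (x , y) eq = O.nxt-≢ i x (cong proj₁ eq)
  asym′ (inj₂ i) (inj₁ j) (x , y) eq = P.nxt-≢ i y (cong proj₂ eq)

relabel : ∀ {Q} (f : J → I) (g : I → J) → (∀ i → f (g i) ≡ i) → (∀ j → g (f j) ≡ j) →
  Orientation Q I → Orientation Q J
relabel f g fg gf O = record
  { nxt = λ j → nxt (f j) ; prv = λ j → prv (f j)
  ; prv-nxt = λ j → prv-nxt (f j) ; nxt-prv = λ j → nxt-prv (f j) ; edge = λ j → edge (f j)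
  ; orient = λ x y e → let (i , p) = orient x y e in
      g i , subst (λ i → nxt i x ≡ y ⊎ nxt i y ≡ x) (sym (fg i)) p
  ; det = λ {i} {j} x eq → trans (sym (gf i)) (trans (cong g (det x eq)) (gf j))
  ; asym = λ i j → asym (f i) (f j) ; flip = λ j → flip (f j) }
  where open Orientation O

-- On vertices of parity false the labels are permuted by the involution π.
twist : ∀ {Q} (π : I → I) → (∀ i → π (π i) ≡ i) → Orientation Q I → Orientation Q I
twist {I} {Q} π ππ O = record
  { nxt = λ i x → nxt (act (par x) i) x
  -- The label is permuted according to the parity of the source, and the predecessor of `x` has the
  -- opposite parity.
  ; prv = λ i x → prv (act (not (par x)) i) x
  ; prv-nxt = λ i x → trans
      (cong (λ b → prv (act b i) (nxt (act (par x) i) x)) (trans (cong not (flip _ x)) (not-involutive _)))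
      (prv-nxt _ x)
  ; nxt-prv = λ i x → trans
      (cong (λ b → nxt (act b i) (prv (act (not (par x)) i) x)) (flip-prv _ x))
      (nxt-prv _ x)
  ; edge = λ i x → edge _ x
  ; orient = orient′
  ; det = λ {i} {j} x eq → trans (sym (act-act (par x) i)) (trans (cong (act (par x)) (det x eq)) (act-act (par x) j))
  ; asym = λ i j x → asym _ _ x
  ; flip = λ i x → flip _ x }
  where
  open Cube Q
  open Orientation O
  act : Bool → I → I
  act b i = if b then i else π i
  act-act : ∀ b i → act b (act b i) ≡ i
  act-act true i = refl
  act-act false i = ππ i
  flip-prv : ∀ i x → par (prv i x) ≡ not (par x)
  flip-prv i x = trans (sym (not-involutive _)) (cong not (trans (sym (flip i _)) (cong par (nxt-prv i x))))
  orient′ : ∀ x y → Edge (enc x) (enc y) → Σ I λ i → nxt (act (par x) i) x ≡ y ⊎ nxt (act (par y) i) y ≡ x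
  orient′ x y e with orient x y e
  ... | i , inj₁ p = act (par x) i , inj₁ (trans (cong (λ i → nxt i x) (act-act (par x) i)) p)
  ... | i , inj₂ p = act (par y) i , inj₂ (trans (cong (λ i → nxt i y) (act-act (par y) i)) p)

-- The cubes of dimension 0 and 2

point : Cube
point = record
  { V = ⊤ ; dim = 0 ; enc = λ _ → [] ; dec = λ _ → tt
  ; dec-enc = λ _ → refl ; enc-dec = λ { [] → refl } ; par = λ _ → false }

point-orientation : (I → ⊥) → Orientation point I
point-orientation ¬I = record
  { nxt = λ _ → id ; prv = λ _ → id ; prv-nxt = λ _ _ → refl ; nxt-prv = λ _ _ → refl
  ; edge = λ i → ⊥-elim (¬I i) ; orient = λ _ _ () ; det = λ {i} → ⊥-elim (¬I i)
  ; asym = λ i → ⊥-elim (¬I i) ; flip = λ i → ⊥-elim (¬I i) }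

square : Cube
square = record
  { V = Bool × Bool ; dim = 2 ; enc = λ (a , b) → a ∷ b ∷ [] ; dec = λ { (a ∷ b ∷ []) → a , b }
  ; dec-enc = λ _ → refl ; enc-dec = λ { (a ∷ b ∷ []) → refl } ; par = λ (a , b) → a xor b }

-- The quarter turn 00 → 10 → 11 → 01 → 00 and its inverse.
rotate unrotate : Bool × Bool → Bool × Bool
rotate (a , b) = not b , a
unrotate (a , b) = b , not a

square-orientation : Orientation square ⊤
square-orientation = record
  { nxt = λ _ → rotate ; prv = λ _ → unrotate
  ; prv-nxt = λ _ (a , b) → cong (a ,_) (not-involutive b)
  ; nxt-prv = λ _ (a , b) → cong (_, b) (not-involutive a)
  ; edge = λ _ → edge′ ; orient = orient′ ; det = λ _ _ → refl ; asym = λ _ _ → asym′ ; flip = λ _ → flip′ }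
  where
  edge′ : ∀ x → Edge (Cube.enc square x) (Cube.enc square (rotate x))
  edge′ (false , false) = here refl refl
  edge′ (false , true) = there refl (here refl refl)
  edge′ (true , false) = there refl (here refl refl)
  edge′ (true , true) = here refl refl
  orient′ : ∀ x y → Edge (Cube.enc square x) (Cube.enc square y) → ⊤ × (rotate x ≡ y ⊎ rotate y ≡ x)
  orient′ (false , false) _ (here refl refl) = tt , inj₁ refl
  orient′ (false , true) _ (here refl refl) = tt , inj₂ refl
  orient′ (true , false) _ (here refl refl) = tt , inj₂ refl
  orient′ (true , true) _ (here refl refl) = tt , inj₁ refl
  orient′ (false , false) _ (there refl (here refl refl)) = tt , inj₂ refl
  orient′ (false , true) _ (there refl (here refl refl)) = tt , inj₁ refl
  orient′ (true , false) _ (there refl (here refl refl)) = tt , inj₁ refl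
  orient′ (true , true) _ (there refl (here refl refl)) = tt , inj₂ refl
  asym′ : ∀ x → rotate (rotate x) ≢ x
  asym′ (a , b) eq = not-¬ refl (sym (cong proj₁ eq))
  flip′ : ∀ x → Cube.par square (rotate x) ≡ not (Cube.par square x)
  flip′ (false , false) = refl
  flip′ (false , true) = refl
  flip′ (true , false) = refl
  flip′ (true , true) = refl

-- Binary counters, least significant bit first

inc decr : Vec Bool n → Vec Bool n
inc [] = []
inc (false ∷ v) = true ∷ v
inc (true ∷ v) = false ∷ inc v
decr [] = []
decr (false ∷ v) = true ∷ decr v
decr (true ∷ v) = false ∷ v

inc-decr : (v : Vec Bool n) → inc (decr v) ≡ v
inc-decr [] = refl
inc-decr (false ∷ v) = cong (false ∷_) (inc-decr v)
inc-decr (true ∷ v) = refl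

decr-inc : (v : Vec Bool n) → decr (inc v) ≡ v
decr-inc [] = refl
decr-inc (false ∷ v) = refl
decr-inc (true ∷ v) = cong (true ∷_) (decr-inc v)

-- Dropping the most significant bit reduces the counter modulo the next lower power of two, hence
-- commutes with `inc`.
low : Vec Bool (suc n) → Vec Bool n
low {zero} _ = []
low {suc n} (b ∷ v) = b ∷ low v

low-inc : (v : Vec Bool (suc n)) → low (inc v) ≡ inc (low v)
low-inc {zero} _ = refl
low-inc {suc n} (false ∷ v) = refl
low-inc {suc n} (true ∷ v) = cong (false ∷_) (low-inc v)

incs : ℕ → Vec Bool n → Vec Bool n
incs zero v = v
incs (suc t) v = inc (incs t v)

incs-inc : ∀ t (v : Vec Bool n) → incs t (inc v) ≡ inc (incs t v)
incs-inc zero v = refl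
incs-inc (suc t) v = cong inc (incs-inc t v)

-- Two increments restore the lowest bit and carry exactly once.
incs-double : ∀ t b (v : Vec Bool n) → incs (t + t) (b ∷ v) ≡ b ∷ incs t v
incs-double zero b v = refl
incs-double (suc t) b v rewrite +-suc t t | incs-double t b v with b
... | false = refl
... | true = refl

halve : ∀ n → Σ ℕ λ h → n ≡ h + h ⊎ n ≡ suc (h + h)
halve zero = 0 , inj₁ refl
halve (suc n) with halve n
... | h , inj₁ refl = h , inj₂ refl
... | h , inj₂ refl = suc h , inj₁ (cong suc (sym (+-suc h h)))

half-< : ∀ {a b} → a + a < 2 * b → a < b
half-< {a} {b} lt with a <? b
... | yes p = p
... | no ¬p = contradiction lt (≤⇒≯ (≤-trans (≤-reflexive (cong (b +_) (+-identityʳ b))) (+-mono-≤ (≮⇒≥ ¬p) (≮⇒≥ ¬p))))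

-- By halving `t`: an odd number of increments changes the lowest bit, and an even number acts as
-- half as many on the remaining bits.
incs-period : ∀ t (v : Vec Bool n) → t < 2 ^ n → incs t v ≡ v → t ≡ 0
incs-period {zero} zero v _ _ = refl
incs-period {zero} (suc t) v (s≤s ()) _
incs-period {suc n} t (b ∷ v) lt eq with halve t
... | h , inj₁ refl rewrite incs-double h b v
  with refl ← incs-period h v (half-< lt) (cong tail eq) = refl
... | h , inj₂ refl rewrite incs-double h b v with b | eq
...   | false | ()
...   | true | ()

decr-incs : ∀ s t (v : Vec Bool n) → s ≤ t → incs s v ≡ incs t v → incs (t ∸ s) v ≡ v
decr-incs zero t v _ eq = sym eq
decr-incs (suc s) (suc t) v (s≤s le) eq =
  decr-incs s t v le (trans (sym (decr-inc _)) (trans (cong decr eq) (decr-inc _)))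

incs-injective : ∀ s t (v : Vec Bool n) → s < 2 ^ n → t < 2 ^ n → incs s v ≡ incs t v → s ≡ t
incs-injective s t v s< t< eq with ≤-total s t
... | inj₁ le = ≤-antisym le (m∸n≡0⇒m≤n (incs-period (t ∸ s) v (≤-<-trans (m∸n≤m t s) t<) (decr-incs s t v le eq)))
... | inj₂ le = ≤-antisym (m∸n≡0⇒m≤n (incs-period (s ∸ t) v (≤-<-trans (m∸n≤m s t) s<) (decr-incs t s v le (sym eq)))) le

zeros : ∀ n → Vec Bool n
zeros n = replicate n false

value : Vec Bool n → ℕ
value [] = 0
value (b ∷ v) = (if b then 1 else 0) + (value v + value v)

value-< : (v : Vec Bool n) → value v < 2 ^ n
value-< [] = s≤s z≤n
value-< {suc n} (b ∷ v) = begin-strict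
  (if b then 1 else 0) + (value v + value v) ≤⟨ +-monoˡ-≤ _ (bit≤1 b) ⟩
  suc (value v + value v)                    <⟨ s≤s (≤-reflexive (sym (+-suc (value v) (value v)))) ⟩
  suc (value v) + suc (value v)              ≤⟨ +-mono-≤ (value-< v) (value-< v) ⟩
  2 ^ n + 2 ^ n                              ≡⟨ cong (2 ^ n +_) (sym (+-identityʳ _)) ⟩
  2 ^ suc n                                  ∎
  where
  open ≤-Reasoning
  bit≤1 : ∀ b → (if b then 1 else 0) ≤ 1
  bit≤1 false = z≤n
  bit≤1 true = ≤-refl

incs-value : (v : Vec Bool n) → incs (value v) (zeros n) ≡ v
incs-value [] = refl
incs-value {suc n} (false ∷ v) = trans (incs-double (value v) false (zeros n)) (cong (false ∷_) (incs-value v))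
incs-value {suc n} (true ∷ v) = cong inc (trans (incs-double (value v) false (zeros n)) (cong (false ∷_) (incs-value v)))

-- Plain orientations and systems

record Plain (Q : Cube) (c : ℕ) : Set₁ where
  open Cube Q
  field
    {Step}      : Set
    orientation : Orientation Q Step
    letters     : Enum Step c
  open Orientation orientation public
  field
    -- This walk is the upper part of a main path, and also what the extra 4-cycles contribute to
    -- its lower part.
    simple : ∀ x → Simple nxt x (word letters)

_×ᵖ_ : ∀ {Q R} → Plain Q m → Plain R n → Plain (Q ×ᶜ R) (m + n)
O ×ᵖ P = record
  { orientation = O.orientation ×ᵒ P.orientation
  ; letters = enum-⊎ O.letters P.letters
  ; simple = λ (x , y) → shuffle-simple
      (subst (λ w → Shuffle _ _ _ x y w _ _) (map-id _)
        (shuffle-⊎ id id id (λ _ _ _ → refl) (λ _ _ _ → refl) x y (word O.letters) (word P.letters)))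
      (subst (Simple O.nxt x) (sym (map-id _)) (O.simple x))
      (subst (Simple P.nxt y) (sym (map-id _)) (P.simple y)) }
  where
  module O = Plain O
  module P = Plain P

plain-point : Plain point 0
plain-point = record { orientation = point-orientation λ () ; letters = enum-⊥ ; simple = λ _ → tt }

rotate-≢ : ∀ x → rotate x ≢ x
rotate-≢ = Orientation.nxt-≢ square-orientation tt

plain-square : Plain square 1
plain-square = record
  { orientation = square-orientation ; letters = enum-⊤ ; simple = λ x → rotate-≢ x , tt }

-- An orientation of Q_{2c} with l dead labels and live labels carrying counters: the dead labels, read in order,
-- spell a simple walk, even when preceded by two steps of the distinguished live label.
record System (c l e : ℕ) : Set₁ where
  field
    {Q}   : Cube
    dim≡  : Cube.dim Q ≡ c + c
    plain : Plain Q c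
  open Cube Q public
  field
    {D U}       : Set
    dead        : Enum D l
    {#U}        : ℕ
    live        : Enum U #U
    orientation : Orientation Q (D ⊎ (⊤ ⊎ U))
  open Orientation orientation public
  p₀ : D ⊎ (⊤ ⊎ U)
  p₀ = inj₂ (inj₁ tt)
  field
    lev     : ⊤ ⊎ U → V → Vec Bool e
    lev-nxt : ∀ u x → lev u (nxt (inj₂ u) x) ≡ inc (lev u x)
    -- The two leading steps are a reserve for doubling: when a live label is demoted there, one
    -- factor makes two `p₀` steps before its dead labels.
    simple  : ∀ x → Simple nxt x (p₀ ∷ p₀ ∷ map inj₁ (word dead))

  -- Every vertex is the `p₀`-successor of some vertex, so the first step may be dropped.
  simple₁ : ∀ x → Simple nxt x (p₀ ∷ map inj₁ (word dead))
  simple₁ x = subst (λ z → Simple nxt z (p₀ ∷ map inj₁ (word dead))) (nxt-prv p₀ x) (proj₂ (simple (prv p₀ x)))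

  simple₀ : ∀ x → Simple nxt x (map inj₁ (word dead))
  simple₀ x = subst (λ z → Simple nxt z (map inj₁ (word dead))) (nxt-prv p₀ x) (proj₂ (simple₁ (prv p₀ x)))

system-square : System 1 0 2
system-square = record
  { dim≡ = refl ; plain = plain-square ; dead = enum-⊥ ; live = enum-⊥
  ; orientation = relabel (λ _ → tt) (λ _ → inj₂ (inj₁ tt)) (λ _ → refl) (λ { (inj₂ (inj₁ tt)) → refl }) square-orientation
  -- The place on the 4-cycle in binary; its lowest bit is the parity.
  ; lev = λ _ (a , b) → (a xor b) ∷ b ∷ []
  ; lev-nxt = λ { _ (false , false) → refl ; _ (false , true) → refl ; _ (true , false) → refl ; _ (true , true) → refl }
  ; simple = λ x → (λ { (inj₁ eq) → rotate-≢ x eq ; (inj₂ eq) → Orientation.asym square-orientation tt tt x eq })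
                 , rotate-≢ _ , tt }

-- Exchanges by parity: doubling and extending systems

module Twist {Q : Cube} (π : I → I) (ππ : ∀ i → π (π i) ≡ i) (O : Orientation Q I) where
  open Cube Q
  private
    module O = Orientation O
    module T = Orientation (twist π ππ O)

  twist-true : ∀ i x → par x ≡ true → T.nxt i x ≡ O.nxt i x
  twist-true i x eq = cong (λ b → O.nxt (if b then i else π i) x) eq

  twist-false : ∀ i x → par x ≡ false → T.nxt i x ≡ O.nxt (π i) x
  twist-false i x eq = cong (λ b → O.nxt (if b then i else π i) x) eq

  twist-fixed : ∀ i → π i ≡ i → ∀ x → T.nxt i x ≡ O.nxt i x
  twist-fixed i fix x with par x
  ... | true = refl
  ... | false = cong (λ i → O.nxt i x) fix

  par-true : ∀ i x → par x ≡ true → par (O.nxt i x) ≡ false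
  par-true i x eq = trans (O.flip i x) (cong not eq)

  par-false : ∀ i x → par x ≡ false → par (O.nxt i x) ≡ true
  par-false i x eq = trans (O.flip i x) (cong not eq)

bool-cases : ∀ b → b ≡ true ⊎ b ≡ false
bool-cases true = inj₁ refl
bool-cases false = inj₂ refl

module Double {c l e} (S : System c l e) where
  open System S hiding (V; par; nxt)
  private
    module S = System S
    L : Set
    L = D ⊎ (⊤ ⊎ U)

  Q² : Cube
  Q² = Q ×ᶜ Q

  open Cube Q² using (V; par)

  -- Exchanges the two copies of each live label. As the twist applies this at parity `false` only
  -- and parity alternates, a live label moves the two factors in turn; each factor advances every
  -- second step and periods double. Dead labels are left alone.
  π : L ⊎ L → L ⊎ L
  π (inj₁ (inj₂ u)) = inj₂ (inj₂ u)
  π (inj₂ (inj₂ u)) = inj₁ (inj₂ u)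
  π i = i

  ππ : ∀ i → π (π i) ≡ i
  ππ (inj₁ (inj₁ d)) = refl
  ππ (inj₁ (inj₂ u)) = refl
  ππ (inj₂ (inj₁ d)) = refl
  ππ (inj₂ (inj₂ u)) = refl

  O² : Orientation Q² (L ⊎ L)
  O² = twist π ππ (orientation ×ᵒ orientation)

  open Orientation O² using (nxt)
  open Twist π ππ (orientation ×ᵒ orientation)

  dim²≡ : Cube.dim Q² ≡ (c + c) + (c + c)
  dim²≡ = cong₂ _+_ dim≡ dim≡

  p q : ⊤ ⊎ U → L ⊎ L
  p u = inj₁ (inj₂ u)
  q u = inj₂ (inj₂ u)

  -- Parity becomes the new lowest bit. A step from parity `true` moves the factor that is counted
  -- and so produces the carry; a step from parity `false` moves the other factor.
  levˡ levʳ : ⊤ ⊎ U → V → Vec Bool (suc e)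
  levˡ u (x , y) = par (x , y) ∷ lev u x
  levʳ u (x , y) = par (x , y) ∷ lev u y

  levˡ-nxt : ∀ u z → levˡ u (nxt (p u) z) ≡ inc (levˡ u z)
  levˡ-nxt u z with bool-cases (par z)
  ... | inj₁ eq rewrite twist-true (p u) z eq | par-true (p u) z eq | eq = cong (false ∷_) (lev-nxt u (proj₁ z))
  ... | inj₂ eq rewrite twist-false (p u) z eq | par-false (q u) z eq | eq = refl

  levʳ-nxt : ∀ u z → levʳ u (nxt (q u) z) ≡ inc (levʳ u z)
  levʳ-nxt u z with bool-cases (par z)
  ... | inj₁ eq rewrite twist-true (q u) z eq | par-true (q u) z eq | eq = cong (false ∷_) (lev-nxt u (proj₂ z))
  ... | inj₂ eq rewrite twist-false (q u) z eq | par-false (p u) z eq | eq = refl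

  W : Vec (D ⊎ D) (l + l)
  W = map inj₁ (word dead) ++ map inj₂ (word dead)

  deadˡ : D ⊎ D → L ⊎ L
  deadˡ (inj₁ d) = inj₁ (inj₁ d)
  deadˡ (inj₂ d) = inj₂ (inj₁ d)

  module _ {K : Set} (f : K → L ⊎ L) (h : D ⊎ D → K) (fh : ∀ d → f (h d) ≡ deadˡ d) where

    shuffle-W : ∀ x y → Shuffle (λ k → nxt (f k)) S.nxt S.nxt x y (map h W) (map inj₁ (word dead)) (map inj₁ (word dead))
    shuffle-W x y = shuffle-⊎ h inj₁ inj₁
      (λ d x y → trans (cong (λ i → nxt i (x , y)) (fh (inj₁ d))) (twist-fixed _ refl (x , y)))
      (λ d x y → trans (cong (λ i → nxt i (x , y)) (fh (inj₂ d))) (twist-fixed _ refl (x , y)))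
      x y (word dead) (word dead)

    module _ {k} (fk : f k ≡ p (inj₁ tt)) where

      private
        nxt-k : ∀ z → nxt (f k) z ≡ nxt (p (inj₁ tt)) z
        nxt-k z = cong (λ i → nxt i z) fk

      -- Two steps of the same label fall in different factors, so each projection is one `p₀` step
      -- followed by the dead labels.
      simple-pp : ∀ z → Simple (λ k → nxt (f k)) z (k ∷ k ∷ map h W)
      simple-pp z@(x , y) with bool-cases (par z)
      ... | inj₁ eq = shuffle-simple
        (left (trans (nxt-k _) (twist-true _ z eq))
        (right (trans (nxt-k _) (twist-false _ _ (par-true (p (inj₁ tt)) z eq)))
        (shuffle-W _ _))) (simple₁ x) (simple₁ y)
      ... | inj₂ eq = shuffle-simple
        (right (trans (nxt-k _) (twist-false _ z eq))
        (left (trans (nxt-k _) (twist-true _ _ (par-false (q (inj₁ tt)) z eq)))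
        (shuffle-W _ _))) (simple₁ x) (simple₁ y)

      -- After two steps the parity is restored, and the step of `q` moves the factor that took the
      -- second step. That factor makes two `p₀` steps before its dead labels, which uses the full
      -- strength of `S.simple`.
      simple-ppq : ∀ {j} → f j ≡ q (inj₁ tt) → ∀ z → Simple (λ k → nxt (f k)) z (k ∷ k ∷ j ∷ map h W)
      simple-ppq {j} fj z@(x , y) with bool-cases (par z)
      ... | inj₁ eq = shuffle-simple
        (left (trans (nxt-k _) (twist-true _ z eq))
        (right (trans (nxt-k _) (twist-false _ _ (par-true (p (inj₁ tt)) z eq)))
        (right (trans (cong (λ i → nxt i _) fj) (twist-true _ _
          (par-false (q (inj₁ tt)) _ (par-true (p (inj₁ tt)) z eq))))
        (shuffle-W _ _)))) (simple₁ x) (S.simple y)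
      ... | inj₂ eq = shuffle-simple
        (right (trans (nxt-k _) (twist-false _ z eq))
        (left (trans (nxt-k _) (twist-true _ _ (par-false (q (inj₁ tt)) z eq)))
        (left (trans (cong (λ i → nxt i _) fj) (twist-false _ _
          (par-true (p (inj₁ tt)) _ (par-false (q (inj₁ tt)) z eq))))
        (shuffle-W _ _)))) (S.simple x) (simple₁ y)

  double : System (c + c) (l + l) (suc e)
  double = record
    { dim≡ = dim²≡ ; plain = plain ×ᵖ plain ; dead = enum-⊎ dead dead
    ; live = enum-⊎ enum-⊤ (enum-⊎ live live)
    ; orientation = relabel f g fg gf O²
    ; lev = lev′ ; lev-nxt = lev′-nxt
    ; simple = simple-pp f inj₁ (λ { (inj₁ d) → refl ; (inj₂ d) → refl }) {inj₂ (inj₁ tt)} refl }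
    where
    f : (D ⊎ D) ⊎ (⊤ ⊎ (⊤ ⊎ (U ⊎ U))) → L ⊎ L
    f (inj₁ d) = deadˡ d
    f (inj₂ (inj₁ _)) = p (inj₁ tt)
    f (inj₂ (inj₂ (inj₁ _))) = q (inj₁ tt)
    f (inj₂ (inj₂ (inj₂ (inj₁ u)))) = p (inj₂ u)
    f (inj₂ (inj₂ (inj₂ (inj₂ u)))) = q (inj₂ u)
    g : L ⊎ L → (D ⊎ D) ⊎ (⊤ ⊎ (⊤ ⊎ (U ⊎ U)))
    g (inj₁ (inj₁ d)) = inj₁ (inj₁ d)
    g (inj₂ (inj₁ d)) = inj₁ (inj₂ d)
    g (inj₁ (inj₂ (inj₁ _))) = inj₂ (inj₁ tt)
    g (inj₂ (inj₂ (inj₁ _))) = inj₂ (inj₂ (inj₁ tt))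
    g (inj₁ (inj₂ (inj₂ u))) = inj₂ (inj₂ (inj₂ (inj₁ u)))
    g (inj₂ (inj₂ (inj₂ u))) = inj₂ (inj₂ (inj₂ (inj₂ u)))
    fg : ∀ i → f (g i) ≡ i
    fg (inj₁ (inj₁ d)) = refl
    fg (inj₂ (inj₁ d)) = refl
    fg (inj₁ (inj₂ (inj₁ _))) = refl
    fg (inj₂ (inj₂ (inj₁ _))) = refl
    fg (inj₁ (inj₂ (inj₂ u))) = refl
    fg (inj₂ (inj₂ (inj₂ u))) = refl
    gf : ∀ k → g (f k) ≡ k
    gf (inj₁ (inj₁ d)) = refl
    gf (inj₁ (inj₂ d)) = refl
    gf (inj₂ (inj₁ _)) = refl
    gf (inj₂ (inj₂ (inj₁ _))) = refl
    gf (inj₂ (inj₂ (inj₂ (inj₁ u)))) = refl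
    gf (inj₂ (inj₂ (inj₂ (inj₂ u)))) = refl
    lev′ : ⊤ ⊎ (⊤ ⊎ (U ⊎ U)) → V → Vec Bool (suc e)
    lev′ (inj₁ _) = levˡ (inj₁ tt)
    lev′ (inj₂ (inj₁ _)) = levʳ (inj₁ tt)
    lev′ (inj₂ (inj₂ (inj₁ u))) = levˡ (inj₂ u)
    lev′ (inj₂ (inj₂ (inj₂ u))) = levʳ (inj₂ u)
    lev′-nxt : ∀ u z → lev′ u (nxt (f (inj₂ u)) z) ≡ inc (lev′ u z)
    lev′-nxt (inj₁ _) = levˡ-nxt (inj₁ tt)
    lev′-nxt (inj₂ (inj₁ _)) = levʳ-nxt (inj₁ tt)
    lev′-nxt (inj₂ (inj₂ (inj₁ u))) = levˡ-nxt (inj₂ u)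
    lev′-nxt (inj₂ (inj₂ (inj₂ u))) = levʳ-nxt (inj₂ u)

  -- Of the two alternating labels made from `p₀`, one stays distinguished and the other becomes the
  -- first dead label.
  double-demote : System (c + c) (suc (l + l)) (suc e)
  double-demote = record
    { dim≡ = dim²≡ ; plain = plain ×ᵖ plain ; dead = enum-⊎ enum-⊤ (enum-⊎ dead dead)
    ; live = enum-⊎ live live
    ; orientation = relabel f g fg gf O²
    ; lev = lev′ ; lev-nxt = lev′-nxt
    ; simple = λ z → subst (λ w → Simple (λ k → nxt (f k)) z (inj₂ (inj₁ tt) ∷ inj₂ (inj₁ tt) ∷ inj₁ (inj₁ tt) ∷ w))
        (map-∘ inj₁ inj₂ W)
        (simple-ppq f (inj₁ ∘ inj₂) (λ { (inj₁ d) → refl ; (inj₂ d) → refl })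
          {inj₂ (inj₁ tt)} refl {inj₁ (inj₁ tt)} refl z) }
    where
    f : (⊤ ⊎ (D ⊎ D)) ⊎ (⊤ ⊎ (U ⊎ U)) → L ⊎ L
    f (inj₁ (inj₁ _)) = q (inj₁ tt)
    f (inj₁ (inj₂ d)) = deadˡ d
    f (inj₂ (inj₁ _)) = p (inj₁ tt)
    f (inj₂ (inj₂ (inj₁ u))) = p (inj₂ u)
    f (inj₂ (inj₂ (inj₂ u))) = q (inj₂ u)
    g : L ⊎ L → (⊤ ⊎ (D ⊎ D)) ⊎ (⊤ ⊎ (U ⊎ U))
    g (inj₁ (inj₁ d)) = inj₁ (inj₂ (inj₁ d))
    g (inj₂ (inj₁ d)) = inj₁ (inj₂ (inj₂ d))
    g (inj₁ (inj₂ (inj₁ _))) = inj₂ (inj₁ tt)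
    g (inj₂ (inj₂ (inj₁ _))) = inj₁ (inj₁ tt)
    g (inj₁ (inj₂ (inj₂ u))) = inj₂ (inj₂ (inj₁ u))
    g (inj₂ (inj₂ (inj₂ u))) = inj₂ (inj₂ (inj₂ u))
    fg : ∀ i → f (g i) ≡ i
    fg (inj₁ (inj₁ d)) = refl
    fg (inj₂ (inj₁ d)) = refl
    fg (inj₁ (inj₂ (inj₁ _))) = refl
    fg (inj₂ (inj₂ (inj₁ _))) = refl
    fg (inj₁ (inj₂ (inj₂ u))) = refl
    fg (inj₂ (inj₂ (inj₂ u))) = refl
    gf : ∀ k → g (f k) ≡ k
    gf (inj₁ (inj₁ _)) = refl
    gf (inj₁ (inj₂ (inj₁ d))) = refl
    gf (inj₁ (inj₂ (inj₂ d))) = refl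
    gf (inj₂ (inj₁ _)) = refl
    gf (inj₂ (inj₂ (inj₁ u))) = refl
    gf (inj₂ (inj₂ (inj₂ u))) = refl
    lev′ : ⊤ ⊎ (U ⊎ U) → V → Vec Bool (suc e)
    lev′ (inj₁ _) = levˡ (inj₁ tt)
    lev′ (inj₂ (inj₁ u)) = levˡ (inj₂ u)
    lev′ (inj₂ (inj₂ u)) = levʳ (inj₂ u)
    lev′-nxt : ∀ u z → lev′ u (nxt (f (inj₂ u)) z) ≡ inc (lev′ u z)
    lev′-nxt (inj₁ _) = levˡ-nxt (inj₁ tt)
    lev′-nxt (inj₂ (inj₁ u)) = levˡ-nxt (inj₂ u)
    lev′-nxt (inj₂ (inj₂ u)) = levʳ-nxt (inj₂ u)

open Double using (double; double-demote)

-- A 4-cycle alone has period 4, too short in general. Exchanging it with `p₀` by parity gives two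
-- labels whose counters gain a parity bit; `low` drops the top bit to keep the common length.
extend : ∀ {c l e} → System c l (suc e) → System (suc c) l (suc e)
extend {c} {l} {e} S = record
  { dim≡ = cong suc (trans (cong suc dim≡) (sym (+-suc c c)))
  ; plain = plain-square ×ᵖ plain ; dead = dead ; live = enum-⊎ enum-⊤ live
  ; orientation = relabel f g fg gf (twist π ππ (square-orientation ×ᵒ orientation))
  ; lev = lev′ ; lev-nxt = lev′-nxt ; simple = simple′ }
  where
  open System S
  L : Set
  L = D ⊎ (⊤ ⊎ U)
  module R = Cube (square ×ᶜ Q)
  π : ⊤ ⊎ L → ⊤ ⊎ L
  π (inj₁ _) = inj₂ (inj₂ (inj₁ tt))
  π (inj₂ (inj₂ (inj₁ _))) = inj₁ tt
  π i = i
  ππ : ∀ i → π (π i) ≡ i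
  ππ (inj₁ _) = refl
  ππ (inj₂ (inj₁ d)) = refl
  ππ (inj₂ (inj₂ (inj₁ _))) = refl
  ππ (inj₂ (inj₂ (inj₂ u))) = refl
  open Twist π ππ (square-orientation ×ᵒ orientation)
  module T = Orientation (twist π ππ (square-orientation ×ᵒ orientation))
  p q : ⊤ ⊎ L
  p = inj₂ (inj₂ (inj₁ tt))
  q = inj₁ tt
  f : D ⊎ (⊤ ⊎ (⊤ ⊎ U)) → ⊤ ⊎ L
  f (inj₁ d) = inj₂ (inj₁ d)
  f (inj₂ (inj₁ _)) = p
  f (inj₂ (inj₂ (inj₁ _))) = q
  f (inj₂ (inj₂ (inj₂ u))) = inj₂ (inj₂ (inj₂ u))
  g : ⊤ ⊎ L → D ⊎ (⊤ ⊎ (⊤ ⊎ U))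
  g (inj₁ _) = inj₂ (inj₂ (inj₁ tt))
  g (inj₂ (inj₁ d)) = inj₁ d
  g (inj₂ (inj₂ (inj₁ _))) = inj₂ (inj₁ tt)
  g (inj₂ (inj₂ (inj₂ u))) = inj₂ (inj₂ (inj₂ u))
  fg : ∀ i → f (g i) ≡ i
  fg (inj₁ _) = refl
  fg (inj₂ (inj₁ d)) = refl
  fg (inj₂ (inj₂ (inj₁ _))) = refl
  fg (inj₂ (inj₂ (inj₂ u))) = refl
  gf : ∀ k → g (f k) ≡ k
  gf (inj₁ d) = refl
  gf (inj₂ (inj₁ _)) = refl
  gf (inj₂ (inj₂ (inj₁ _))) = refl
  gf (inj₂ (inj₂ (inj₂ u))) = refl
  lev′ : ⊤ ⊎ (⊤ ⊎ U) → R.V → Vec Bool (suc e)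
  lev′ (inj₁ _) z = R.par z ∷ low (lev (inj₁ tt) (proj₂ z))
  -- The bit is negated because `q` moves the factor `Q` from parity `false`.
  lev′ (inj₂ (inj₁ _)) z = not (R.par z) ∷ low (lev (inj₁ tt) (proj₂ z))
  lev′ (inj₂ (inj₂ u)) z = lev (inj₂ u) (proj₂ z)
  low-lev : ∀ x → low (lev (inj₁ tt) (nxt p₀ x)) ≡ inc (low (lev (inj₁ tt) x))
  low-lev x = trans (cong low (lev-nxt (inj₁ tt) x)) (low-inc _)
  lev′-nxt : ∀ u z → lev′ u (T.nxt (f (inj₂ u)) z) ≡ inc (lev′ u z)
  lev′-nxt (inj₁ _) z with bool-cases (R.par z)
  ... | inj₁ eq rewrite twist-true p z eq | par-true p z eq | eq = cong (false ∷_) (low-lev (proj₂ z))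
  ... | inj₂ eq rewrite twist-false p z eq | par-false q z eq | eq = refl
  lev′-nxt (inj₂ (inj₁ _)) z with bool-cases (R.par z)
  ... | inj₁ eq rewrite twist-true q z eq | par-true q z eq | eq = refl
  ... | inj₂ eq rewrite twist-false q z eq | par-false p z eq | eq = cong (false ∷_) (low-lev (proj₂ z))
  lev′-nxt (inj₂ (inj₂ u)) z rewrite twist-fixed (inj₂ (inj₂ (inj₂ u))) refl z = lev-nxt (inj₂ u) (proj₂ z)
  shuffle-W : ∀ x y → Shuffle (λ k → T.nxt (f k)) (λ _ → rotate) nxt x y (map inj₁ (word dead)) [] (map inj₁ (word dead))
  shuffle-W x y = shuffle-right inj₁ inj₁ (λ d x y → twist-fixed _ refl (x , y)) x y (word dead)
  k₀ : D ⊎ (⊤ ⊎ (⊤ ⊎ U))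
  k₀ = inj₂ (inj₁ tt)
  simple′ : ∀ z → Simple (λ k → T.nxt (f k)) z (k₀ ∷ k₀ ∷ map inj₁ (word dead))
  simple′ z@(x , y) with bool-cases (R.par z)
  ... | inj₁ eq = shuffle-simple
    (right {k = k₀} (twist-true p z eq) (left {k = k₀} {i = tt} (twist-false p _ (par-true p z eq)) (shuffle-W _ _)))
    (rotate-≢ x , tt) (simple₁ y)
  ... | inj₂ eq = shuffle-simple
    (left {k = k₀} {i = tt} (twist-false p z eq) (right {k = k₀} (twist-true p _ (par-false q z eq)) (shuffle-W _ _)))
    (rotate-≢ x , tt) (simple₁ y)

-- f is fuel for the recursion by halving c.
system : ∀ f c → 1 ≤ c → c ≤ f → Σ ℕ λ s → Σ ℕ λ l → suc (c + l) ≡ 2 ^ s × System c l (suc s)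
system zero c 1≤c c≤0 = contradiction (≤-trans 1≤c c≤0) λ ()
system (suc f) c 1≤c c≤f with halve c
... | zero , inj₁ refl = contradiction 1≤c λ ()
... | zero , inj₂ refl = 1 , 0 , refl , system-square
... | suc h , inj₁ refl with system f (suc h) (s≤s z≤n) (≤-trans (≤-trans (m≤m+n _ h) (≤-reflexive (sym (+-suc h h)))) (s≤s⁻¹ c≤f))
-- Doubling `c` has to double `1 + c + l`, so one more label must be dead.
...   | s , l , eq , S = suc s , suc (l + l) ,
        trans (solve 2 (λ h l → con 1 :+ ((con 1 :+ h) :+ (con 1 :+ h) :+ (con 1 :+ (l :+ l)))
                             := con 2 :* (con 1 :+ ((con 1 :+ h) :+ l))) refl h l) (cong (2 *_) eq) ,
        double-demote S
system (suc f) c 1≤c c≤f | suc h , inj₂ refl with system f (suc h) (s≤s z≤n) (≤-trans (m≤m+n _ (suc h)) (s≤s⁻¹ c≤f))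
-- Here the added 4-cycle supplies the missing unit, so no label is demoted.
...   | s , l , eq , S = suc s , l + l ,
        trans (solve 2 (λ h l → con 1 :+ (con 1 :+ ((con 1 :+ h) :+ (con 1 :+ h)) :+ (l :+ l))
                             := con 2 :* (con 1 :+ ((con 1 :+ h) :+ l))) refl h l) (cong (2 *_) eq) ,
        extend (double S)

-- Live labels are grouped into rounds of d letters, one round for each u : U; N rounds form a simple walk.
record Thread (U : Set) (c l d N : ℕ) : Set₁ where
  field
    {Q}   : Cube
    dim≡  : Cube.dim Q ≡ c + c
    plain : Plain Q c
  open Cube Q public
  field
    {D Φ}       : Set
    dead        : Enum D l
    phases      : Enum Φ d
    orientation : Orientation Q (D ⊎ (U × Φ))
  open Orientation orientation public
  round : U → Vec (D ⊎ (U × Φ)) d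
  round u = map (λ φ → inj₂ (u , φ)) (word phases)
  field
    simpleᴰ : ∀ x → Simple nxt x (map inj₁ (word dead))
    simpleᵁ : ∀ u x → Simple nxt x (concat (replicate N (round u)))

-- Start vertices for the rounds: every N-th vertex along the rounds of u.
record Start {U c l d N} (T : Thread U c l d N) : Set where
  open Thread T
  field
    start  : U → V → Bool
    unique : ∀ u x → Σ (Fin N) λ q → start u (rewind^ prv (toℕ q) (round u) x) ≡ true ×
      (∀ q′ → start u (rewind^ prv (toℕ q′) (round u) x) ≡ true → q′ ≡ q)

-- From systems to threads

isZeros : Vec Bool n → Bool
isZeros [] = true
isZeros (b ∷ v) = if b then false else isZeros v

isZeros-zeros : ∀ n → isZeros (zeros n) ≡ true
isZeros-zeros zero = refl
isZeros-zeros (suc n) = isZeros-zeros n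

isZeros⇒≡ : (v : Vec Bool n) → isZeros v ≡ true → v ≡ zeros n
isZeros⇒≡ [] _ = refl
isZeros⇒≡ (false ∷ v) eq = cong (false ∷_) (isZeros⇒≡ v eq)

incs-cancel : ∀ t {v w : Vec Bool n} → incs t v ≡ incs t w → v ≡ w
incs-cancel zero eq = eq
incs-cancel (suc t) eq = incs-cancel t (trans (sym (decr-inc _)) (trans (cong decr eq) (decr-inc _)))

module _ {X I : Set} {e : ℕ} (nxt : I → X → X) (i : I) (lev : X → Vec Bool e)
  (lev-nxt : ∀ x → lev (nxt i x) ≡ inc (lev x)) where

  visits-level : ∀ N x v → Visits nxt x (concat (replicate N (i ∷ []))) v → Σ ℕ λ t → t ≤ N × lev v ≡ incs t (lev x)
  visits-level zero x v refl = 0 , z≤n , refl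
  visits-level (suc N) x v (inj₁ refl) = 0 , z≤n , refl
  visits-level (suc N) x v (inj₂ vis) with visits-level N (nxt i x) v vis
  ... | t , t≤N , eq = suc t , s≤s t≤N , trans eq (trans (cong (incs t) (lev-nxt x)) (incs-inc t _))

  -- A return would give the counter a positive period of at most `N`, below `2 ^ e`.
  simple-level : ∀ N x → N < 2 ^ e → Simple nxt x (concat (replicate N (i ∷ [])))
  simple-level zero x _ = tt
  simple-level (suc N) x N< = ¬visits , simple-level N (nxt i x) (<-trans (n<1+n N) N<)
    where
    ¬visits : ¬ Visits nxt (nxt i x) (concat (replicate N (i ∷ []))) x
    ¬visits vis with visits-level N (nxt i x) x vis
    ... | t , t≤N , eq with incs-period (suc t) (lev x) (≤-<-trans (s≤s t≤N) N<)
                              (sym (trans eq (trans (cong (incs t) (lev-nxt x)) (incs-inc t _))))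
    ...   | ()

module _ {c l s} (S : System c l (suc s)) where
  open System S

  private
    f : D ⊎ ((⊤ ⊎ U) × ⊤) → D ⊎ (⊤ ⊎ U)
    f (inj₁ d) = inj₁ d
    f (inj₂ (u , _)) = inj₂ u

  -- A walk of `2 ^ s` steps has `2 ^ s + 1` vertices; the counter has `s + 1` bits, and the extra
  -- bit keeps the two ends apart.
  system-thread : Thread (⊤ ⊎ U) c l 1 (2 ^ s)
  system-thread = record
    { dim≡ = dim≡ ; plain = plain ; dead = dead ; phases = enum-⊤
    ; orientation = relabel f [ inj₁ , (λ u → inj₂ (u , tt)) ]
        (λ { (inj₁ d) → refl ; (inj₂ u) → refl }) (λ { (inj₁ d) → refl ; (inj₂ u) → refl }) orientation
    ; simpleᴰ = λ x → simple-relabel x (word dead) (simple₀ x)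
    ; simpleᵁ = λ u x → simple-level (λ k → nxt (f k)) (inj₂ (u , tt)) (lev u) (lev-nxt u) (2 ^ s) x
        (^-monoʳ-< 2 (s≤s (s≤s z≤n)) (n<1+n s)) }
    where
    visits-relabel : ∀ x (w : Vec D n) {v} → Visits (λ k → nxt (f k)) x (map inj₁ w) v → Visits nxt x (map inj₁ w) v
    visits-relabel x [] vis = vis
    visits-relabel x (i ∷ w) (inj₁ eq) = inj₁ eq
    visits-relabel x (i ∷ w) (inj₂ vis) = inj₂ (visits-relabel _ w vis)
    simple-relabel : ∀ x (w : Vec D n) → Simple nxt x (map inj₁ w) → Simple (λ k → nxt (f k)) x (map inj₁ w)
    simple-relabel x [] σ = tt
    simple-relabel x (i ∷ w) (¬v , σ) = ¬v ∘ visits-relabel _ w , simple-relabel _ w σ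

  -- Starts are the vertices whose counter is divisible by `2 ^ s`; the counter modulo `2 ^ s` is
  -- the number of steps since the last start.
  system-start : Start system-thread
  system-start = record
    { start = λ u x → isZeros (bits u x)
    ; unique = λ u x → offset u x , at-offset u x , λ q eq → toℕ-injective
        (incs-injective (toℕ q) (toℕ (offset u x)) (zeros s) (toℕ<n q) (toℕ<n (offset u x))
          (trans (cong (incs (toℕ q)) (sym (isZeros⇒≡ _ eq))) (trans (low-rewind u (toℕ q) x) (sym (incs-offset u x))))) }
    where
    module T = Thread system-thread
    bits : ⊤ ⊎ U → V → Vec Bool s
    bits u x = low (lev u x)
    offset : ⊤ ⊎ U → V → Fin (2 ^ s)
    offset u x = fromℕ< (value-< (bits u x))
    incs-offset : ∀ u x → incs (toℕ (offset u x)) (zeros s) ≡ bits u x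
    incs-offset u x = trans (cong (λ t → incs t (zeros s)) (toℕ-fromℕ< (value-< (bits u x)))) (incs-value (bits u x))
    rewound : ⊤ ⊎ U → ℕ → V → V
    rewound u q x = rewind^ T.prv q (T.round u) x
    low-rewind : ∀ u q x → incs q (low (lev u (rewound u q x))) ≡ low (lev u x)
    low-rewind u zero x = refl
    low-rewind u (suc q) x =
      trans (sym (incs-inc q _))
      (trans (cong (incs q) (trans (sym (low-inc _))
        (cong low (trans (sym (lev-nxt u _)) (cong (lev u) (nxt-prv (inj₂ u) _))))))
      (low-rewind u q x))
    at-offset : ∀ u x → isZeros (bits u (rewound u (toℕ (offset u x)) x)) ≡ true
    at-offset u x = trans
      (cong isZeros (incs-cancel (toℕ (offset u x)) (trans (low-rewind u (toℕ (offset u x)) x) (sym (incs-offset u x)))))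
      (isZeros-zeros s)

-- Products of threads

module _ {U : Set} {c l d c′ l′ d′ N : ℕ} (S : Thread U c l d N) (T : Thread U c′ l′ d′ N) where
  private
    module S = Thread S
    module T = Thread T

    f : (S.D ⊎ T.D) ⊎ (U × (S.Φ ⊎ T.Φ)) → (S.D ⊎ (U × S.Φ)) ⊎ (T.D ⊎ (U × T.Φ))
    f (inj₁ (inj₁ d)) = inj₁ (inj₁ d)
    f (inj₁ (inj₂ d)) = inj₂ (inj₁ d)
    f (inj₂ (u , inj₁ φ)) = inj₁ (inj₂ (u , φ))
    f (inj₂ (u , inj₂ φ)) = inj₂ (inj₂ (u , φ))

    g : (S.D ⊎ (U × S.Φ)) ⊎ (T.D ⊎ (U × T.Φ)) → (S.D ⊎ T.D) ⊎ (U × (S.Φ ⊎ T.Φ))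
    g (inj₁ (inj₁ d)) = inj₁ (inj₁ d)
    g (inj₂ (inj₁ d)) = inj₁ (inj₂ d)
    g (inj₁ (inj₂ (u , φ))) = inj₂ (u , inj₁ φ)
    g (inj₂ (inj₂ (u , φ))) = inj₂ (u , inj₂ φ)

    fg : ∀ i → f (g i) ≡ i
    fg (inj₁ (inj₁ d)) = refl
    fg (inj₂ (inj₁ d)) = refl
    fg (inj₁ (inj₂ (u , φ))) = refl
    fg (inj₂ (inj₂ (u , φ))) = refl

    gf : ∀ i → g (f i) ≡ i
    gf (inj₁ (inj₁ d)) = refl
    gf (inj₁ (inj₂ d)) = refl
    gf (inj₂ (u , inj₁ φ)) = refl
    gf (inj₂ (u , inj₂ φ)) = refl

  -- The factors share `U` and `N`: a product round is a round of the first followed by one of the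
  -- second, and `N` product rounds project to `N` rounds in each.
  _×ᵗ_ : Thread U (c + c′) (l + l′) (d + d′) N
  _×ᵗ_ = record
    { dim≡ = trans (cong₂ _+_ S.dim≡ T.dim≡)
        (solve 2 (λ c c′ → (c :+ c) :+ (c′ :+ c′) := (c :+ c′) :+ (c :+ c′)) refl c c′)
    ; plain = S.plain ×ᵖ T.plain
    ; dead = enum-⊎ S.dead T.dead
    ; phases = enum-⊎ S.phases T.phases
    ; orientation = relabel f g fg gf (S.orientation ×ᵒ T.orientation)
    ; simpleᴰ = λ (x , y) → shuffle-simple
        (shuffle-⊎ inj₁ inj₁ inj₁ (λ _ _ _ → refl) (λ _ _ _ → refl) x y (word S.dead) (word T.dead))
        (S.simpleᴰ x) (T.simpleᴰ y)
    ; simpleᵁ = λ u (x , y) → shuffle-simple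
        (shuffle-concat N (λ x y → shuffle-⊎ (λ φ → inj₂ (u , φ)) (λ φ → inj₂ (u , φ)) (λ φ → inj₂ (u , φ))
          (λ _ _ _ → refl) (λ _ _ _ → refl) x y (word S.phases) (word T.phases)) x y)
        (S.simpleᵁ u x) (T.simpleᵁ u y) }

  -- Rewinding product rounds projects to rewinding rounds of the first factor, so that factor alone
  -- can decide where to start.
  start-×ᵗ : Start S → Start _×ᵗ_
  start-×ᵗ st = record
    { start = λ u (x , y) → start u x
    ; unique = λ u z → let (q , eq , uniq) = unique u (proj₁ z) in
        q , trans (cong (start u) (proj₁-rewind^ u (toℕ q) z)) eq ,
        λ q′ eq′ → uniq q′ (trans (cong (start u) (sym (proj₁-rewind^ u (toℕ q′) z))) eq′) }
    where
    open Start st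
    module P = Thread _×ᵗ_
    proj₁-rewind : ∀ u (v : Vec S.Φ m) (w : Vec T.Φ n) z →
      proj₁ (rewind P.prv (map (λ φ → inj₂ (u , φ)) (map inj₁ v ++ map inj₂ w)) z) ≡
      rewind S.prv (map (λ φ → inj₂ (u , φ)) v) (proj₁ z)
    proj₁-rewind u [] [] z = refl
    proj₁-rewind u [] (φ ∷ w) z = proj₁-rewind u [] w z
    proj₁-rewind u (φ ∷ v) w z = cong (S.prv _) (proj₁-rewind u v w z)
    proj₁-rewind^ : ∀ u q z → proj₁ (rewind^ P.prv q (P.round u) z) ≡ rewind^ S.prv q (S.round u) (proj₁ z)
    proj₁-rewind^ u zero z = refl
    proj₁-rewind^ u (suc q) z = trans (proj₁-rewind u (word S.phases) (word T.phases) (rewind^ P.prv q (P.round u) z))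
      (cong (rewind S.prv (S.round u)) (proj₁-rewind^ u q z))

-- All labels are dead and the rounds are empty. This adds the extra 4-cycles and gives the empty
-- product in `copies`.
plain-thread : ∀ {Q U c} N → Cube.dim Q ≡ c + c → Plain Q c → Thread U c c 0 N
plain-thread {Q} {U} {c} N dim≡ O = record
  { dim≡ = dim≡ ; plain = O ; dead = letters ; phases = enum-⊥
  ; orientation = relabel f inj₁ (λ _ → refl) (λ { (inj₁ i) → refl }) orientation
  ; simpleᴰ = λ x → simple-relabel x (word letters) (simple x)
  ; simpleᵁ = λ u x → simple-empty N x }
  where
  open Cube Q
  open Plain O
  f : Step ⊎ (U × ⊥) → Step
  f (inj₁ i) = i
  visits-relabel : ∀ x (w : Vec Step n) {v} → Visits (λ k → nxt (f k)) x (map inj₁ w) v → Visits nxt x w v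
  visits-relabel x [] vis = vis
  visits-relabel x (i ∷ w) (inj₁ eq) = inj₁ eq
  visits-relabel x (i ∷ w) (inj₂ vis) = inj₂ (visits-relabel _ w vis)
  simple-relabel : ∀ x (w : Vec Step n) → Simple nxt x w → Simple (λ k → nxt (f k)) x (map inj₁ w)
  simple-relabel x [] σ = tt
  simple-relabel x (i ∷ w) (¬v , σ) = ¬v ∘ visits-relabel _ w , simple-relabel _ w σ
  simple-empty : ∀ N x → Simple (λ k → nxt (f k)) x (concat (replicate N []))
  simple-empty zero x = tt
  simple-empty (suc N) x = simple-empty N x

squares : ∀ h → Σ Cube λ Q → Cube.dim Q ≡ h + h × Plain Q h
squares zero = point , refl , plain-point
squares (suc h) with squares h
... | Q , eq , O = square ×ᶜ Q , cong suc (trans (cong suc eq) (sym (+-suc h h))) , plain-square ×ᵖ O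

copies : ∀ {U c l d N} n → Thread U c l d N → Thread U (n * c) (n * l) (n * d) N
copies zero T = plain-thread _ refl plain-point
copies (suc n) T = T ×ᵗ copies n T

-- Serves the case `c = 0`: without live labels there are no rounds, and the main paths cover every
-- edge.
point-thread : Thread ⊥ 0 0 1 1
point-thread = record
  { dim≡ = refl ; plain = plain-point ; dead = enum-⊥ ; phases = enum-⊤
  ; orientation = point-orientation λ { (inj₁ ()) ; (inj₂ ()) }
  ; simpleᴰ = λ _ → tt ; simpleᵁ = λ () }

-- Families of paths

-- A path decomposition of an abstract directed graph with arcs `A`: the two-sided inverse `locate`
-- of `arc` says that each arc is used at exactly one place.
record Family {X A : Set} (src tgt : A → X) (k : ℕ) : Set₁ where
  field
    {P}      : Set
    {#P}     : ℕ
    paths    : Enum P #P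
    vertex   : P → Fin (suc k) → X
    simple   : ∀ p {s t} → vertex p s ≡ vertex p t → s ≡ t
    arc      : P → Fin k → A
    src-arc  : ∀ p t → src (arc p t) ≡ vertex p (inject₁ t)
    tgt-arc  : ∀ p t → tgt (arc p t) ≡ vertex p (suc t)
    locate   : A → P × Fin k
    arc-locate : ∀ a → uncurry arc (locate a) ≡ a
    locate-arc : ∀ p t → locate (arc p t) ≡ (p , t)

family-⊎ : {src tgt : A → X} {src′ tgt′ : B → X} →
  Family src tgt k → Family src′ tgt′ k → Family [ src , src′ ] [ tgt , tgt′ ] k
family-⊎ F G = record
  { paths = enum-⊎ F.paths G.paths
  ; vertex = [ F.vertex , G.vertex ]
  ; simple = λ { (inj₁ p) → F.simple p ; (inj₂ p) → G.simple p }
  ; arc = λ { (inj₁ p) t → inj₁ (F.arc p t) ; (inj₂ p) t → inj₂ (G.arc p t) }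
  ; src-arc = λ { (inj₁ p) → F.src-arc p ; (inj₂ p) → G.src-arc p }
  ; tgt-arc = λ { (inj₁ p) → F.tgt-arc p ; (inj₂ p) → G.tgt-arc p }
  ; locate = λ { (inj₁ a) → let (p , t) = F.locate a in inj₁ p , t ; (inj₂ a) → let (p , t) = G.locate a in inj₂ p , t }
  ; arc-locate = λ { (inj₁ a) → cong inj₁ (F.arc-locate a) ; (inj₂ a) → cong inj₂ (G.arc-locate a) }
  ; locate-arc = λ { (inj₁ p) t → cong (λ (p , t) → inj₁ p , t) (F.locate-arc p t)
                   ; (inj₂ p) t → cong (λ (p , t) → inj₂ p , t) (G.locate-arc p t) } }
  where
  module F = Family F
  module G = Family G

family-map : {src tgt : A → X} {src′ tgt′ : B → X} (f : A → B) (g : B → A) →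
  (∀ b → f (g b) ≡ b) → (∀ a → g (f a) ≡ a) →
  (∀ a → src′ (f a) ≡ src a) → (∀ a → tgt′ (f a) ≡ tgt a) → Family src tgt k → Family src′ tgt′ k
family-map f g fg gf eqˢ eqᵗ F = record
  { paths = paths ; vertex = vertex ; simple = simple ; arc = λ p t → f (arc p t)
  ; src-arc = λ p t → trans (eqˢ _) (src-arc p t)
  ; tgt-arc = λ p t → trans (eqᵗ _) (tgt-arc p t)
  ; locate = locate ∘ g
  ; arc-locate = λ b → trans (cong f (arc-locate (g b))) (fg b)
  ; locate-arc = λ p t → trans (cong locate (gf _)) (locate-arc p t) }
  where open Family F

-- Cutting paths into pieces

module _ {q k : ℕ} where

  private
    piece-< : ∀ (i : Fin q) (t : Fin (suc k)) → k * toℕ i + toℕ t < suc (q * k)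
    piece-< i t = s≤s (begin
      k * toℕ i + toℕ t ≤⟨ +-monoʳ-≤ (k * toℕ i) (s≤s⁻¹ (toℕ<n t)) ⟩
      k * toℕ i + k     ≡⟨ trans (+-comm (k * toℕ i) k) (sym (*-suc k (toℕ i))) ⟩
      k * suc (toℕ i)   ≤⟨ *-monoʳ-≤ k (toℕ<n i) ⟩
      k * q             ≡⟨ *-comm k q ⟩
      q * k             ∎)
      where open ≤-Reasoning

  -- Piece `i` starts at vertex `k * i`, so consecutive pieces share an end vertex but no edge.
  piece : Fin q → Fin (suc k) → Fin (suc (q * k))
  piece i t = fromℕ< (piece-< i t)

  piece-inject₁ : ∀ i t → piece i (inject₁ t) ≡ inject₁ (combine i t)
  piece-inject₁ i t = toℕ-injective (trans (toℕ-fromℕ< _) (trans (cong (k * toℕ i +_) (toℕ-inject₁ t))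
    (sym (trans (toℕ-inject₁ _) (toℕ-combine i t)))))

  piece-suc : ∀ i t → piece i (suc t) ≡ suc (combine i t)
  piece-suc i t = toℕ-injective (trans (toℕ-fromℕ< _) (trans (+-suc (k * toℕ i) (toℕ t)) (cong suc (sym (toℕ-combine i t)))))

  piece-injective : ∀ i {s t} → piece i s ≡ piece i t → s ≡ t
  piece-injective i {s} {t} eq = toℕ-injective (+-cancelˡ-≡ (k * toℕ i) _ _
    (trans (sym (toℕ-fromℕ< (piece-< i s))) (trans (cong toℕ eq) (toℕ-fromℕ< (piece-< i t)))))

family-cut : {src tgt : A → X} → ∀ q k → Family src tgt (q * k) → Family src tgt k
family-cut q k F = record
  { paths = enum-× paths (enum-Fin q)
  ; vertex = λ (p , i) t → vertex p (piece i t)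
  ; simple = λ (p , i) eq → piece-injective {q} i (simple p eq)
  ; arc = λ (p , i) t → arc p (combine i t)
  ; src-arc = λ (p , i) t → trans (src-arc p _) (cong (vertex p) (sym (piece-inject₁ i t)))
  ; tgt-arc = λ (p , i) t → trans (tgt-arc p _) (cong (vertex p) (sym (piece-suc i t)))
  ; locate = λ a → let (p , t) = locate a ; (i , j) = remQuot {q} k t in (p , i) , j
  ; arc-locate = λ a → trans (cong (arc _) (combine-remQuot {q} k _)) (arc-locate a)
  ; locate-arc = λ (p , i) t → trans
      (cong (λ (p , t) → let (i , j) = remQuot {q} k t in (p , i) , j) (locate-arc p (combine i t)))
      (cong (λ (i , j) → (p , i) , j) (remQuot-combine i t)) }
  where open Family F

-- Directions are forgotten here. A path may traverse an edge either way, so `unique` also compares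
-- an arc with the reverse of another.
family-decomposition : {src tgt : A → X} (enc : X → Vertex n) → (∀ {x y} → enc x ≡ enc y → x ≡ y) →
  (∀ a → Adjacent (enc (src a)) (enc (tgt a))) →
  (∀ v w → Adjacent v w → Σ A λ a → (enc (src a) ≡ v × enc (tgt a) ≡ w) ⊎ (enc (src a) ≡ w × enc (tgt a) ≡ v)) →
  (∀ a b → (src a ≡ src b × tgt a ≡ tgt b) ⊎ (src a ≡ tgt b × tgt a ≡ src b) → a ≡ b) →
  Family src tgt k → PathDecomposition n k
family-decomposition {A = A} {X} {n} {k} {src} {tgt} enc enc-inj adj cover unique F =
  #P , path , λ v w vw → let (a , ends) = cover v w vw in decompose v w a ends
  where
  open Family F
  path : Fin #P → Path n k
  path j = record
    { vert = enc ∘ vertex (lookup (word paths) j)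
    ; distinct = simple (lookup (word paths) j) ∘ enc-inj
    ; steps = λ i → let p = lookup (word paths) j in
        subst (λ x → Adjacent (enc x) (enc (vertex p (suc i)))) (src-arc p i)
          (subst (λ y → Adjacent (enc (src (arc p i))) (enc y)) (tgt-arc p i) (adj (arc p i))) }
  Ends : A → Vertex n → Vertex n → Set
  Ends a v w = (enc (src a) ≡ v × enc (tgt a) ≡ w) ⊎ (enc (src a) ≡ w × enc (tgt a) ≡ v)
  ends-unique : ∀ {v w} a b → Ends a v w → Ends b v w → a ≡ b
  ends-unique a b (inj₁ (p , q)) (inj₁ (r , s)) = unique a b (inj₁ (enc-inj (trans p (sym r)) , enc-inj (trans q (sym s))))
  ends-unique a b (inj₁ (p , q)) (inj₂ (r , s)) = unique a b (inj₂ (enc-inj (trans p (sym s)) , enc-inj (trans q (sym r))))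
  ends-unique a b (inj₂ (p , q)) (inj₁ (r , s)) = unique a b (inj₂ (enc-inj (trans p (sym s)) , enc-inj (trans q (sym r))))
  ends-unique a b (inj₂ (p , q)) (inj₂ (r , s)) = unique a b (inj₁ (enc-inj (trans p (sym r)) , enc-inj (trans q (sym s))))
  arcAt : Fin #P → Fin k → A
  arcAt j = arc (lookup (word paths) j)
  step⇒ends : ∀ j i {v w} → StepIs (path j) i v w → Ends (arcAt j i) v w
  step⇒ends j i (inj₁ (p , q)) = inj₁ (trans (cong enc (src-arc _ i)) p , trans (cong enc (tgt-arc _ i)) q)
  step⇒ends j i (inj₂ (p , q)) = inj₂ (trans (cong enc (src-arc _ i)) p , trans (cong enc (tgt-arc _ i)) q)
  ends⇒step : ∀ j i {v w} → Ends (arcAt j i) v w → StepIs (path j) i v w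
  ends⇒step j i (inj₁ (p , q)) = inj₁ (trans (cong enc (sym (src-arc _ i))) p , trans (cong enc (sym (tgt-arc _ i))) q)
  ends⇒step j i (inj₂ (p , q)) = inj₂ (trans (cong enc (sym (src-arc _ i))) p , trans (cong enc (sym (tgt-arc _ i))) q)
  arcAt-locate : ∀ a → arcAt (pos paths (proj₁ (locate a))) (proj₂ (locate a)) ≡ a
  arcAt-locate a = trans (cong (λ p → arc p (proj₂ (locate a))) (word-pos paths _)) (arc-locate a)
  locate-arcAt : ∀ j i a → arcAt j i ≡ a → j ≡ pos paths (proj₁ (locate a)) × i ≡ proj₂ (locate a)
  locate-arcAt j i _ refl = trans (sym (pos-word paths j)) (cong (pos paths ∘ proj₁) (sym (locate-arc _ i))) ,
    cong proj₂ (sym (locate-arc _ i))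
  decompose : ∀ v w a → Ends a v w → Σ (Fin #P × Fin k) λ { (j , i) → StepIs (path j) i v w ×
    ((j′ : Fin #P) (i′ : Fin k) → StepIs (path j′) i′ v w → (j′ ≡ j) × (i′ ≡ i)) }
  decompose v w a ends = (pos paths (proj₁ (locate a)) , proj₂ (locate a)) ,
    ends⇒step _ _ (subst (λ a → Ends a v w) (sym (arcAt-locate a)) ends) ,
    λ j i step → locate-arcAt j i a (ends-unique _ _ (step⇒ends j i step) ends)

-- Main paths (ᴹ) start at every vertex of the lower half; each label acts on V alone, crossing as the identity,
-- and the bit of a label is the half containing the sources of its arcs.  Rounds (ᴿ) stay in the lower half.
module Assembly {U : Set} {c l d N u : ℕ} (enumᵁ : Enum U u) (T : Thread U c l d N) (st : Start T) where
  open Thread T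
  open Start st
  private
    module P = Plain plain

  Label : Set
  Label = D ⊎ (⊤ ⊎ P.Step)

  enum-V : Enum V (2 ^ dim)
  enum-V = enum-map dec enc dec-enc enc-dec (enum-Vertex dim)

  letters : Enum Label (l + suc c)
  letters = enum-⊎ dead (enum-⊎ enum-⊤ P.letters)

  mv mv⁻¹ : Label → V → V
  mv (inj₁ d) = nxt (inj₁ d)
  mv (inj₂ (inj₁ _)) = id
  mv (inj₂ (inj₂ j)) = P.nxt j
  mv⁻¹ (inj₁ d) = prv (inj₁ d)
  mv⁻¹ (inj₂ (inj₁ _)) = id
  mv⁻¹ (inj₂ (inj₂ j)) = P.prv j

  mv-mv⁻¹ : ∀ s x → mv s (mv⁻¹ s x) ≡ x
  mv-mv⁻¹ (inj₁ d) = nxt-prv (inj₁ d)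
  mv-mv⁻¹ (inj₂ (inj₁ _)) x = refl
  mv-mv⁻¹ (inj₂ (inj₂ j)) = P.nxt-prv j

  mv⁻¹-mv : ∀ s x → mv⁻¹ s (mv s x) ≡ x
  mv⁻¹-mv (inj₁ d) = prv-nxt (inj₁ d)
  mv⁻¹-mv (inj₂ (inj₁ _)) x = refl
  mv⁻¹-mv (inj₂ (inj₂ j)) = P.prv-nxt j

  mvᵇ : Label → Bool → Bool
  mvᵇ (inj₂ (inj₁ _)) = not
  mvᵇ _ = id

  mv² : Label → V × Bool → V × Bool
  mv² s (x , b) = mv s x , mvᵇ s b

  bit : Label → Bool
  bit (inj₂ (inj₂ _)) = true
  bit _ = false

  srcᴹ tgtᴹ : V × Label → V × Bool
  srcᴹ (x , s) = x , bit s
  tgtᴹ (x , s) = mv² s (x , bit s)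

  at-mv² : ∀ x b (w : Vec Label n) t → at mv² (x , b) w t ≡ (at mv x w t , at mvᵇ b w t)
  at-mv² x b w zero = refl
  at-mv² x b (s ∷ w) (suc t) = at-mv² _ _ w t

  up : Vec P.Step n → Vec Label n
  up v = map inj₂ (map inj₂ v)

  main : Vec D m → Vec P.Step n → Vec Label (m + suc n)
  main w v = map inj₁ w ++ inj₂ (inj₁ tt) ∷ up v

  at-up : ∀ (v : Vec P.Step n) t → at mvᵇ true (up v) (inject₁ t) ≡ bit (lookup (up v) t)
  at-up (j ∷ v) zero = refl
  at-up (j ∷ v) (suc t) = at-up v t

  -- Along a main path the next letter determines the current half, so its arcs can be indexed by a
  -- vertex of `V` and a label alone.
  at-main : ∀ (w : Vec D m) (v : Vec P.Step n) t → at mvᵇ false (main w v) (inject₁ t) ≡ bit (lookup (main w v) t)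
  at-main [] v zero = refl
  at-main [] v (suc t) = at-up v t
  at-main (d ∷ w) v zero = refl
  at-main (d ∷ w) v (suc t) = at-main w v t

  visits-up : ∀ x (v : Vec P.Step n) {y b} → Visits mv² (x , true) (up v) (y , b) → Visits P.nxt x v y × b ≡ true
  visits-up x [] refl = refl , refl
  visits-up x (j ∷ v) (inj₁ refl) = inj₁ refl , refl
  visits-up x (j ∷ v) (inj₂ vis) = let (vis′ , eq) = visits-up _ v vis in inj₂ vis′ , eq

  simple-up : ∀ x (v : Vec P.Step n) → Simple P.nxt x v → Simple mv² (x , true) (up v)
  simple-up x [] _ = tt
  simple-up x (j ∷ v) (¬v , σ) = ¬v ∘ proj₁ ∘ visits-up _ v , simple-up _ v σ

  visits-main : ∀ x (w : Vec D m) (v : Vec P.Step n) {y} → Visits mv² (x , false) (main w v) (y , false) →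
    Visits nxt x (map inj₁ w) y
  visits-main x [] v (inj₁ refl) = refl
  visits-main x [] v (inj₂ vis) with visits-up x v vis
  ... | _ , ()
  visits-main x (d ∷ w) v (inj₁ refl) = inj₁ refl
  visits-main x (d ∷ w) v (inj₂ vis) = inj₂ (visits-main _ w v vis)

  -- The walk crosses once between disjoint halves, so simplicity can be checked in each half
  -- separately.
  simple-main : ∀ x (w : Vec D m) (v : Vec P.Step n) → Simple nxt x (map inj₁ w) → (∀ x → Simple P.nxt x v) →
    Simple mv² (x , false) (main w v)
  simple-main x [] v _ τ = (λ vis → case-⊥ (proj₂ (visits-up x v vis))) , simple-up x v (τ x)
    where
    case-⊥ : ¬ false ≡ true
    case-⊥ ()
  simple-main x (d ∷ w) v (¬v , σ) τ = ¬v ∘ visits-main _ w v , simple-main _ w v σ τ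

  -- Each label occurs once in `w` and acts on `V` as a permutation, so the arc at `x` with label
  -- `s` lies on the one path whose start `back` computes.
  familyᴹ : Family srcᴹ tgtᴹ (l + suc c)
  familyᴹ = record
    { paths = enum-V
    ; vertex = λ z → at mv² (z , false) w
    ; simple = λ z → at-injective mv² (z , false) w (simple-main z (word dead) (word P.letters) (simpleᴰ z) P.simple)
    ; arc = arc
    ; src-arc = src-arc
    ; tgt-arc = λ z t → trans (cong (mv² (lookup w t)) (src-arc z t)) (sym (at-suc mv² (z , false) w t))
    ; locate = λ (x , s) → back mv⁻¹ w (pos letters s) x , pos letters s
    ; arc-locate = λ (x , s) → cong₂ _,_ (at-back mv mv⁻¹ mv-mv⁻¹ w (pos letters s) x) (word-pos letters s)
    ; locate-arc = λ z t → trans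
        (cong (λ i → back mv⁻¹ w i (at mv z w (inject₁ t)) , i) (pos-word letters t))
        (cong (_, t) (back-at mv mv⁻¹ mv⁻¹-mv w t z)) }
    where
    w : Vec Label (l + suc c)
    w = word letters
    arc : V → Fin (l + suc c) → V × Label
    arc z t = at mv z w (inject₁ t) , lookup w t
    src-arc : ∀ z t → srcᴹ (arc z t) ≡ at mv² (z , false) w (inject₁ t)
    src-arc z t = trans (cong (at mv z w (inject₁ t) ,_) (sym (at-main (word dead) (word P.letters) t)))
      (sym (at-mv² z false w (inject₁ t)))

  srcᴿ tgtᴿ : V × (U × Φ) → V × Bool
  srcᴿ (x , _) = x , false
  tgtᴿ (x , i) = nxt (inj₂ i) x , false

  -- An arc is located by undoing its round up to its phase and then whole rounds until a start is
  -- met; `unique` fixes their number below `N`.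
  familyᴿ : Family srcᴿ tgtᴿ (N * d)
  familyᴿ = record
    { paths = proj₂ (enum-filter (enum-× enumᵁ enum-V) (uncurry start))
    ; vertex = λ ((u , z) , _) t → at nxt z (rounds u) t , false
    ; simple = λ ((u , z) , _) eq → at-injective nxt z (rounds u) (simpleᵁ u z) (cong proj₁ eq)
    ; arc = arc
    ; src-arc = λ _ _ → refl
    ; tgt-arc = λ ((u , z) , _) t → cong (_, false)
        (trans (cong (λ i → nxt i (at nxt z (rounds u) (inject₁ t))) (sym (lookup-rounds u t)))
               (sym (at-suc nxt z (rounds u) t)))
    ; locate = locate
    ; arc-locate = λ (x , u , φ) → let q = proj₁ (unique u (back prv (round u) (pos phases φ) x)) in
        cong₂ (λ x φ → x , u , φ)
          (trans (cong (λ z → at nxt z (rounds u) (inject₁ (combine q (pos phases φ))))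
                   (sym (back-concat prv N (round u) q (pos phases φ) x)))
                 (at-back nxt prv nxt-prv (rounds u) (combine q (pos phases φ)) x))
          (trans (cong (lookup (word phases) ∘ proj₂) (remQuot-combine q (pos phases φ))) (word-pos phases φ))
    ; locate-arc = locate-arc }
    where
    R : Set
    R = Σ (U × V) λ (u , z) → start u z ≡ true
    rounds : U → Vec (D ⊎ (U × Φ)) (N * d)
    rounds u = concat (replicate N (round u))
    phase : Fin (N * d) → Fin d
    phase t = proj₂ (remQuot {N} d t)
    lookup-rounds : ∀ u t → lookup (rounds u) t ≡ inj₂ (u , lookup (word phases) (phase t))
    lookup-rounds u t = begin
      lookup (rounds u) t                               ≡⟨ cong (lookup (rounds u)) (sym (combine-remQuot {N} d t)) ⟩
      lookup (rounds u) (combine (proj₁ (remQuot {N} d t)) (phase t))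
                                                        ≡⟨ lookup-concat (replicate N (round u)) (proj₁ (remQuot {N} d t)) (phase t) ⟩
      lookup (lookup (replicate N (round u)) (proj₁ (remQuot {N} d t))) (phase t)
                                                        ≡⟨ cong (λ w → lookup w (phase t)) (lookup-replicate (proj₁ (remQuot {N} d t)) (round u)) ⟩
      lookup (round u) (phase t)                        ≡⟨ lookup-map (phase t) _ (word phases) ⟩
      inj₂ (u , lookup (word phases) (phase t))         ∎
      where open ≡-Reasoning
    arc : R → Fin (N * d) → V × (U × Φ)
    arc ((u , z) , _) t = at nxt z (rounds u) (inject₁ t) , u , lookup (word phases) (phase t)
    locate : V × (U × Φ) → R × Fin (N * d)
    locate (x , u , φ) =
      let y = back prv (round u) (pos phases φ) x
          (q , eq , _) = unique u y
      in ((u , rewind^ prv (toℕ q) (round u) y) , eq) , combine q (pos phases φ)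
    locate-≡ : ∀ x u φ q z (eq : start u z ≡ true) → rewind^ prv (toℕ q) (round u) (back prv (round u) (pos phases φ) x) ≡ z →
      locate (x , u , φ) ≡ (((u , z) , eq) , combine q (pos phases φ))
    locate-≡ x u φ q z eq refl with unique u (back prv (round u) (pos phases φ) x)
    ... | q₀ , eq₀ , uniq with uniq q eq
    -- Uniqueness has identified the numbers of rounds; `uip` identifies the two proofs of being a
    -- start.
    ...   | refl = cong (λ eq → ((u , z) , eq) , combine q (pos phases φ)) (uip eq₀ eq)
    locate-arc : ∀ p t → locate (arc p t) ≡ (p , t)
    locate-arc ((u , z) , eq) t = trans
      (locate-≡ (at nxt z (rounds u) (inject₁ t)) u (lookup (word phases) (phase t)) q z eq (begin
        rewind^ prv (toℕ q) (round u) (back prv (round u) (pos phases (lookup (word phases) (phase t))) x)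
          ≡⟨ cong (λ i → rewind^ prv (toℕ q) (round u) (back prv (round u) i x)) (pos-word phases (phase t)) ⟩
        rewind^ prv (toℕ q) (round u) (back prv (round u) (phase t) x)
          ≡⟨ sym (back-concat prv N (round u) q (phase t) x) ⟩
        back prv (rounds u) (combine q (phase t)) x
          ≡⟨ cong (λ t → back prv (rounds u) t x) (combine-remQuot {N} d t) ⟩
        back prv (rounds u) t x
          ≡⟨ back-at nxt prv prv-nxt (rounds u) t z ⟩
        z ∎))
      (cong (((u , z) , eq) ,_) (trans (cong (combine q) (pos-word phases (phase t))) (combine-remQuot {N} d t)))
      where
      open ≡-Reasoning
      q : Fin N
      q = proj₁ (remQuot {N} d t)
      x : V
      x = at nxt z (rounds u) (inject₁ t)

  Arc : Set
  Arc = V × ((D ⊎ (U × Φ)) ⊎ (⊤ ⊎ P.Step))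

  src tgt : Arc → V × Bool
  src (x , inj₁ i) = x , false
  src (x , inj₂ (inj₁ _)) = x , false
  src (x , inj₂ (inj₂ j)) = x , true
  tgt (x , inj₁ i) = nxt i x , false
  tgt (x , inj₂ (inj₁ _)) = x , true
  tgt (x , inj₂ (inj₂ j)) = P.nxt j x , true

  -- Main paths take the dead, crossing and upper arcs, rounds the live ones; the equation gives
  -- both kinds the same length.
  family : l + suc c ≡ N * d → Family src tgt (N * d)
  family eq = family-map f g fg gf srcf tgtf (family-⊎ (subst (Family srcᴹ tgtᴹ) eq familyᴹ) familyᴿ)
    where
    f : (V × Label) ⊎ (V × (U × Φ)) → Arc
    f (inj₁ (x , inj₁ d)) = x , inj₁ (inj₁ d)
    f (inj₁ (x , inj₂ j)) = x , inj₂ j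
    f (inj₂ (x , i)) = x , inj₁ (inj₂ i)
    g : Arc → (V × Label) ⊎ (V × (U × Φ))
    g (x , inj₁ (inj₁ d)) = inj₁ (x , inj₁ d)
    g (x , inj₁ (inj₂ i)) = inj₂ (x , i)
    g (x , inj₂ j) = inj₁ (x , inj₂ j)
    fg : ∀ a → f (g a) ≡ a
    fg (x , inj₁ (inj₁ d)) = refl
    fg (x , inj₁ (inj₂ i)) = refl
    fg (x , inj₂ j) = refl
    gf : ∀ a → g (f a) ≡ a
    gf (inj₁ (x , inj₁ d)) = refl
    gf (inj₁ (x , inj₂ j)) = refl
    gf (inj₂ (x , i)) = refl
    srcf : ∀ a → src (f a) ≡ [ srcᴹ , srcᴿ ] a
    srcf (inj₁ (x , inj₁ d)) = refl
    srcf (inj₁ (x , inj₂ (inj₁ _))) = refl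
    srcf (inj₁ (x , inj₂ (inj₂ j))) = refl
    srcf (inj₂ (x , i)) = refl
    tgtf : ∀ a → tgt (f a) ≡ [ tgtᴹ , tgtᴿ ] a
    tgtf (inj₁ (x , inj₁ d)) = refl
    tgtf (inj₁ (x , inj₂ (inj₁ _))) = refl
    tgtf (inj₁ (x , inj₂ (inj₂ j))) = refl
    tgtf (inj₂ (x , i)) = refl

  enc⁺ : V × Bool → Vertex (suc dim)
  enc⁺ (x , b) = b ∷ enc x

  enc⁺-injective : ∀ {x y} → enc⁺ x ≡ enc⁺ y → x ≡ y
  enc⁺-injective eq = cong₂ _,_ (Cube.enc-injective Q (cong tail eq)) (cong head eq)

  adjacent : ∀ a → Adjacent (enc⁺ (src a)) (enc⁺ (tgt a))
  adjacent (x , inj₁ i) = edge⇒adjacent (there refl (edge i x))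
  adjacent (x , inj₂ (inj₁ _)) = edge⇒adjacent (here refl refl)
  adjacent (x , inj₂ (inj₂ j)) = edge⇒adjacent (there refl (P.edge j x))

  cover : ∀ v w → Adjacent v w →
    Σ Arc λ a → (enc⁺ (src a) ≡ v × enc⁺ (tgt a) ≡ w) ⊎ (enc⁺ (src a) ≡ w × enc⁺ (tgt a) ≡ v)
  cover x y xy with adjacent⇒edge x y xy
  ... | here {b = false} {v = v} refl refl = (dec v , inj₂ (inj₁ tt)) ,
          inj₁ (cong (false ∷_) (enc-dec v) , cong (true ∷_) (enc-dec v))
  ... | here {b = true} {v = v} refl refl = (dec v , inj₂ (inj₁ tt)) ,
          inj₂ (cong (false ∷_) (enc-dec v) , cong (true ∷_) (enc-dec v))
  ... | there {b = false} {v = v} {w} refl e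
      with orient (dec v) (dec w) (subst (λ v → Edge v (enc (dec w))) (sym (enc-dec v)) (subst (Edge v) (sym (enc-dec w)) e))
  ...   | i , inj₁ eq = (dec v , inj₁ i) , inj₁ (cong (false ∷_) (enc-dec v) ,
            cong (false ∷_) (trans (cong enc eq) (enc-dec w)))
  ...   | i , inj₂ eq = (dec w , inj₁ i) , inj₂ (cong (false ∷_) (enc-dec w) ,
            cong (false ∷_) (trans (cong enc eq) (enc-dec v)))
  cover x y xy | there {b = true} {v = v} {w} refl e
      with P.orient (dec v) (dec w) (subst (λ v → Edge v (enc (dec w))) (sym (enc-dec v)) (subst (Edge v) (sym (enc-dec w)) e))
  ...   | i , inj₁ eq = (dec v , inj₂ (inj₂ i)) , inj₁ (cong (true ∷_) (enc-dec v) ,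
            cong (true ∷_) (trans (cong enc eq) (enc-dec w)))
  ...   | i , inj₂ eq = (dec w , inj₂ (inj₂ i)) , inj₂ (cong (true ∷_) (enc-dec w) ,
            cong (true ∷_) (trans (cong enc eq) (enc-dec v)))

  -- The halves of the end vertices separate arcs of different kinds. Inside a half, `det`
  -- identifies parallel arcs and `asym` excludes opposite ones.
  arc-unique : ∀ a b → (src a ≡ src b × tgt a ≡ tgt b) ⊎ (src a ≡ tgt b × tgt a ≡ src b) → a ≡ b
  arc-unique (x , inj₁ i) (y , inj₁ j) (inj₁ (refl , eq)) = cong (λ i → x , inj₁ i) (det x (cong proj₁ eq))
  arc-unique (x , inj₁ i) (y , inj₁ j) (inj₂ (refl , eq)) = ⊥-elim (asym i j y (cong proj₁ eq))
  arc-unique (x , inj₁ i) (y , inj₂ (inj₁ _)) (inj₁ (_ , ()))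
  arc-unique (x , inj₁ i) (y , inj₂ (inj₁ _)) (inj₂ (() , _))
  arc-unique (x , inj₁ i) (y , inj₂ (inj₂ j)) (inj₁ (() , _))
  arc-unique (x , inj₁ i) (y , inj₂ (inj₂ j)) (inj₂ (() , _))
  arc-unique (x , inj₂ (inj₁ _)) (y , inj₁ j) (inj₁ (_ , ()))
  arc-unique (x , inj₂ (inj₁ _)) (y , inj₁ j) (inj₂ (_ , ()))
  arc-unique (x , inj₂ (inj₁ _)) (y , inj₂ (inj₁ _)) (inj₁ (refl , _)) = refl
  arc-unique (x , inj₂ (inj₁ _)) (y , inj₂ (inj₁ _)) (inj₂ (() , _))
  arc-unique (x , inj₂ (inj₁ _)) (y , inj₂ (inj₂ j)) (inj₁ (() , _))
  arc-unique (x , inj₂ (inj₁ _)) (y , inj₂ (inj₂ j)) (inj₂ (() , _))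
  arc-unique (x , inj₂ (inj₂ i)) (y , inj₁ j) (inj₁ (() , _))
  arc-unique (x , inj₂ (inj₂ i)) (y , inj₁ j) (inj₂ (() , _))
  arc-unique (x , inj₂ (inj₂ i)) (y , inj₂ (inj₁ _)) (inj₁ (() , _))
  arc-unique (x , inj₂ (inj₂ i)) (y , inj₂ (inj₁ _)) (inj₂ (_ , ()))
  arc-unique (x , inj₂ (inj₂ i)) (y , inj₂ (inj₂ j)) (inj₁ (refl , eq)) = cong (λ i → x , inj₂ (inj₂ i)) (P.det x (cong proj₁ eq))
  arc-unique (x , inj₂ (inj₂ i)) (y , inj₂ (inj₂ j)) (inj₂ (refl , eq)) = ⊥-elim (P.asym i j y (cong proj₁ eq))

  decomposition : ∀ {q k} → l + suc c ≡ N * d → N * d ≡ q * k → PathDecomposition (suc (c + c)) k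
  decomposition {q} {k} eq eq′ = subst (λ n → PathDecomposition (suc n) k) dim≡
    (family-decomposition enc⁺ enc⁺-injective adjacent cover arc-unique
      (family-cut q k (subst (Family src tgt) eq′ (family eq))))

-- Choice of the parameters

thread-decomposition : ∀ {U u c l s′} → Enum U u → (T : Thread U c l 1 (2 ^ s′)) → Start T → suc (c + l) ≡ 2 ^ s′ →
  ∀ s h → 2 ^ s ≤ suc (c + c) → PathDecomposition (suc (c + c) * suc (h + h)) (2 ^ s * suc (h + h))
thread-decomposition {c = c} {l} {s′} enumᵁ T st eq s h 2^s≤ =
  subst (λ n → PathDecomposition n (2 ^ s * d)) size
    -- The first copy of `T` supplies the starts for the whole product, as `copies d T` is `T` times
    -- `h + h` further copies.
    (Assembly.decomposition enumᵁ (T^d ×ᵗ H) (start-×ᵗ T^d H (start-×ᵗ T (copies (h + h) T) st)) {2 ^ (s′ ∸ s)} length-≡ cut-≡)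
  where
  d : ℕ
  d = suc (h + h)
  T^d : Thread _ (d * c) (d * l) (d * 1) (2 ^ s′)
  T^d = copies d T
  -- The extra 4-cycles add `2h` dimensions, which with the coordinate separating the halves
  -- complete `2cd` to `(2c + 1) d`.
  H : Thread _ h h 0 (2 ^ s′)
  H = let (_ , dim≡ , O) = squares h in plain-thread _ dim≡ O
  size : suc ((d * c + h) + (d * c + h)) ≡ suc (c + c) * d
  size = solve 2 (λ c h → let d = con 1 :+ (h :+ h) in
    con 1 :+ ((d :* c :+ h) :+ (d :* c :+ h)) := (con 1 :+ (c :+ c)) :* d) refl c h
  length-≡ : (d * l + h) + suc (d * c + h) ≡ 2 ^ s′ * (d * 1 + 0)
  length-≡ = trans
    (solve 3 (λ c h l → let d = con 1 :+ (h :+ h) in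
      (d :* l :+ h) :+ (con 1 :+ (d :* c :+ h)) := (con 1 :+ (c :+ l)) :* (d :* con 1 :+ con 0)) refl c h l)
    (cong (_* (d * 1 + 0)) eq)
  -- Otherwise `2 ^ s` would be at least `2 ^ suc s′`, which equals `2 * (1 + c + l)` and exceeds
  -- `1 + 2c`.
  s≤s′ : s ≤ s′
  s≤s′ with s ≤? s′
  ... | yes p = p
  ... | no ¬p = contradiction (begin
    suc (suc (c + c))         ≤⟨ s≤s (s≤s (≤-trans (m≤m+n _ (l + l)) (≤-reflexive
                                   (solve 2 (λ c l → (c :+ c) :+ (l :+ l) := (c :+ l) :+ (c :+ l)) refl c l)))) ⟩
    suc (suc ((c + l) + (c + l))) ≡⟨ solve 1 (λ x → con 1 :+ (con 1 :+ (x :+ x)) := con 2 :* (con 1 :+ x)) refl (c + l) ⟩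
    2 * suc (c + l)           ≡⟨ cong (2 *_) eq ⟩
    2 ^ suc s′                ≤⟨ ^-monoʳ-≤ 2 (≰⇒> ¬p) ⟩
    2 ^ s                     ≤⟨ 2^s≤ ⟩
    suc (c + c)               ∎) 1+n≰n
    where open ≤-Reasoning
  cut-≡ : 2 ^ s′ * (d * 1 + 0) ≡ 2 ^ (s′ ∸ s) * (2 ^ s * d)
  cut-≡ = begin
    2 ^ s′ * (d * 1 + 0)           ≡⟨ cong₂ _*_ (cong (2 ^_) (sym (m∸n+n≡m s≤s′))) (trans (+-identityʳ _) (*-identityʳ d)) ⟩
    2 ^ (s′ ∸ s + s) * d           ≡⟨ cong (_* d) (^-distribˡ-+-* 2 (s′ ∸ s) s) ⟩
    2 ^ (s′ ∸ s) * 2 ^ s * d       ≡⟨ *-assoc (2 ^ (s′ ∸ s)) (2 ^ s) d ⟩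
    2 ^ (s′ ∸ s) * (2 ^ s * d)     ∎
    where open ≡-Reasoning

point-start : Start point-thread
point-start = record { start = λ () ; unique = λ () }

odd-decomposition : ∀ c s h → 2 ^ s ≤ suc (c + c) → PathDecomposition (suc (c + c) * suc (h + h)) (2 ^ s * suc (h + h))
odd-decomposition zero = thread-decomposition {s′ = 0} enum-⊥ point-thread point-start refl
odd-decomposition (suc c) with system (suc c) (suc c) (s≤s z≤n) ≤-refl
... | s′ , l , eq , S = thread-decomposition {s′ = s′} (enum-⊎ enum-⊤ (System.live S)) (system-thread S) (system-start S) eq

-- f is fuel, as in system.
odd-part : ∀ f k → 0 < k → k ≤ f → Σ ℕ λ s → Σ ℕ λ h → k ≡ 2 ^ s * suc (h + h)
odd-part zero k 0<k k≤0 = contradiction (≤-trans 0<k k≤0) λ ()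
odd-part (suc f) k 0<k k≤f with halve k
... | zero , inj₁ refl = contradiction 0<k λ ()
... | h , inj₂ refl = 0 , h , sym (+-identityʳ _)
... | suc j , inj₁ refl
    with s , h , eq ← odd-part f (suc j) z<s (≤-trans (≤-trans (m≤m+n _ j) (≤-reflexive (sym (+-suc j j)))) (s≤s⁻¹ k≤f))
    = suc s , h , (begin
      suc j + suc j               ≡⟨ cong (suc j +_) (sym (+-identityʳ (suc j))) ⟩
      2 * suc j                   ≡⟨ cong (2 *_) eq ⟩
      2 * (2 ^ s * suc (h + h))   ≡⟨ sym (*-assoc 2 (2 ^ s) (suc (h + h))) ⟩
      2 ^ suc s * suc (h + h)     ∎)
    where open ≡-Reasoning

-- Divisibility by odd numbers

2∣h+h : ∀ h → 2 ∣ h + h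
2∣h+h h = divides h (solve 1 (λ h → h :+ h := h :* con 2) refl h)

2∤odd : ∀ h → ¬ 2 ∣ suc (h + h)
2∤odd h 2∣ = contradiction (∣⇒≤ (∣m+n∣m⇒∣n (subst (2 ∣_) (+-comm 1 (h + h)) 2∣) (2∣h+h h))) λ { (s≤s ()) }

odd-coprime-2 : ∀ h → Coprime (suc (h + h)) 2
odd-coprime-2 h {zero} (_ , 0∣2) = contradiction (0∣⇒≡0 0∣2) λ ()
odd-coprime-2 h {1} _ = refl
odd-coprime-2 h {2} (2∣ , _) = contradiction 2∣ (2∤odd h)
odd-coprime-2 h {suc (suc (suc i))} (_ , i∣2) = contradiction (∣⇒≤ i∣2) λ { (s≤s (s≤s ())) }

-- The factors 2 are removed one at a time, each being coprime to the odd divisor.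
odd∣-cancel-2^ : ∀ h a {n} → suc (h + h) ∣ 2 ^ a * n → suc (h + h) ∣ n
odd∣-cancel-2^ h zero d∣ = subst (suc (h + h) ∣_) (+-identityʳ _) d∣
odd∣-cancel-2^ h (suc a) {n} d∣ =
  odd∣-cancel-2^ h a (coprime-divisor (odd-coprime-2 h) (subst (suc (h + h) ∣_) (*-assoc 2 (2 ^ a) n) d∣))

theorem1p2 : (n k : ℕ) → (∃ λ m → n ≡ 2 * m + 1) → 0 < k → k ∣ n * 2 ^ (n ∸ 1) → k ≤ n →
    PathDecomposition n k
theorem1p2 n k (m , n≡) 0<k k∣ k≤n with odd-part k k 0<k ≤-refl
-- The odd part of `k` divides `n * 2 ^ (n ∸ 1)`, hence `n`.
... | s , h , refl with odd∣-cancel-2^ h (n ∸ 1)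
        (subst (suc (h + h) ∣_) (*-comm n (2 ^ (n ∸ 1))) (∣-trans (divides (2 ^ s) refl) k∣))
...   | divides q refl with halve q
-- Cancelling the odd part of `k` in `k ≤ n` leaves the bound on `2 ^ s`.
...     | c , inj₂ refl = odd-decomposition c s h (*-cancelʳ-≤ (2 ^ s) (suc (c + c)) (suc (h + h)) k≤n)
-- An even quotient would make `n` even.
...     | c , inj₁ refl = contradiction (∣m⇒∣m*n (suc (h + h)) (2∣h+h c))
          (subst (λ n → ¬ 2 ∣ n) (sym (trans n≡ (solve 1 (λ m → con 2 :* m :+ con 1 := con 1 :+ (m :+ m)) refl m))) (2∤odd m))
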